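{- Let $(x_\beta^*,z_\beta^*)$ be an optimal solution of $\min_{x,z}\Psi(x,z)$ and set $\mathcal{Q}=I+D\mathcal{W}^{ -1}D^T$. Suppose that $\{(x^k,z^k)\}_{k\ge 1}$ is the sequence generated by Algorithm 2 (defined in the context) from an initial point $z^0\in\mathbb{R}^{2n^2}$. Then for any $k\ge 1$, $$\Psi(x^k,z^k)-\Psi(x_\beta^*,z_\beta^*)\le \frac{2\beta\,\|z^0-z_\beta^*\|_{\mathcal{Q}}^2}{(k+1)^2}.$$
   Context: Let $n,m$ be positive integers, $\mathcal{K}\in\mathbb{R}^{m\times n^2}$, $f\in\mathbb{R}^m$, $\mu>0$, $\beta>0$. Finite differences: for $x=(x_1,\dots,x_{n^2})^T\in\mathbb{R}^{n^2}$ (an $n\times n$ image as a column vector) and $i=1,\dots,n^2$, let $(D^{(1)}x)_i=x_{i+n}-x_i$ if $1\le i\le n(n-1)$ and $(D^{(1)}x)_i=x_{i-n(n-1)}-x_i$ otherwise; let $(D^{(2)}x)_i=x_{i-n+1}-x_i$ if $i\in\{n,2n,\dots,n^2\}$ and $(D^{(2)}x)_i=x_{i+1}-x_i$ otherwise. Put $D_ix=((D^{(1)}x)_i,(D^{(2)}x)_i)^T\in\mathbb{R}^2$ and $D=((D^{(1)})^T,(D^{(2)})^T)^T\in\mathbb{R}^{2n^2\times n^2}$. For $z\in\mathbb{R}^{2n^2}$, written as $z=((z^{(1)})^T,(z^{(2)})^T)^T$ with $z^{(1)},z^{(2)}\in\mathbb{R}^{n^2}$, put $z_i=(z^{(1)}_i,z^{(2)}_i)^T\in\mathbb{R}^2$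 for $i=1,\dots,n^2$. Standing assumption: $\ker\mathcal{K}\cap\ker D=\{0\}$. Objective: for $x\in\mathbb{R}^{n^2}$, $z\in\mathbb{R}^{2n^2}$, $$\Psi(x,z)=\sum_{i=1}^{n^2}\|z_i\|_2+\frac{\beta}{2}\sum_{i=1}^{n^2}\|z_i-D_ix\|_2^2+\frac{\mu}{2}\|\mathcal{K}x-f\|_2^2.$$ Notation: $\mathcal{W}=D^TD+\frac{\mu}{\beta}\mathcal{K}^T\mathcal{K}$ (nonsingular by the standing assumption), and $\|u\|_{\mathcal{H}}^2=\langle u,\mathcal{H}u\rangle$ for a symmetric positive semidefinite matrix $\mathcal{H}$. Algorithm 2: given $z^0\in\mathbb{R}^{2n^2}$, set $\widehat z^1=z^0$, $t_1=1$. For $k=1,2,\dots$: (1) $\overline{x}^k$ is the solution of $\mathcal{W}\overline{x}^k=D^T\widehat z^k+\frac{\mu}{\beta}\mathcal{K}^Tf$; (2) $z^k$ is given by $z^k_i=\max\{\|D_i\overline{x}^k\|_2-\frac1\beta,0\}\,\frac{D_i\overline{x}^k}{\|D_i\overline{x}^k\|_2}$, $i=1,\dots,n^2$, with the convention $0\cdot(0/0)=0$; (3) $x^k$ is the solution of $\mathcal{W}x^k=D^Tz^k+\frac{\mu}{\beta}\mathcal{K}^Tf$; (4) $t_{k+1}=\frac{1+\sqrt{1+4t_k^2}}{2}$ and $\widehat z^{k+1}=z^k+\frac{t_k-1}{t_{k+1}}(z^k-z^{k-1})$. -}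

module Defs where

open import Algebra.Bundles using (CommutativeRing)
import Algebra.Construct.NaturalChoice.Max as Max
import Algebra.Properties.CommutativeSemigroup as CommutativeSemigroupProperties
import Algebra.Properties.Ring as RingProperties
import Algebra.Properties.Semiring.Exp as Exp
import Algebra.Properties.Semiring.Mult as Mult
import Algebra.Properties.Semiring.Sum as Sum
open import Data.Bool.Base using (if_then_else_)
open import Data.Fin.Base as Fin using (Fin; zero; suc; toℕ; fromℕ<; _↑ˡ_; _↑ʳ_)
open import Data.Fin.Properties as Fin using (toℕ<n; ¬∀⟶∃¬)
open import Data.Nat.Base as ℕ using (ℕ; zero; suc; NonZero)
open import Data.Nat.Divisibility using (_∣_; _∣?_; m∣m*n)
import Data.Nat.Properties as ℕ
open import Data.Product.Base using (∃; _×_; _,_; proj₁; proj₂)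
open import Data.Sum.Base using (inj₁; inj₂)
open import Data.Vec.Functional using (Vector; []; _∷_; _++_)
open import Function.Base using (_∘_)
open import Level using (0ℓ)
open import Relation.Binary.Bundles using (TotalOrder)
import Relation.Binary.Construct.NonStrictToStrict as ToStrict
open import Relation.Binary.Core using (Rel)
open import Relation.Binary.PropositionalEquality.Core as ≡ using (_≡_)
import Relation.Binary.Reasoning.Setoid as SetoidReasoning
open import Relation.Binary.Structures using (IsDecTotalOrder)
open import Relation.Nullary.Decidable.Core using (yes; no; does)
open import Relation.Nullary.Negation.Core using (¬_; contradiction)

-- The real numbers, given by the classical axioms that determine them up to
-- isomorphism: a totally ordered field in which every nonempty set that is
-- bounded above has a least upper bound.  Decidability of ≈ and ≤ is the
-- classical trichotomy.  Under excluded middle, Dedekind cuts of ℚ are an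
-- instance.

record RealField : Set₁ where
  field
    commutativeRing : CommutativeRing 0ℓ 0ℓ

  open CommutativeRing commutativeRing public hiding (zero) renaming (Carrier to ℝ)

  infix 4 _≤_

  field
    0≉1             : 0# ≉ 1#
    inverse         : ∀ x → x ≉ 0# → ∃ λ y → x * y ≈ 1#
    _≤_             : Rel ℝ 0ℓ
    isDecTotalOrder : IsDecTotalOrder _≈_ _≤_
    +-monoˡ-≤       : ∀ z {x y} → x ≤ y → z + x ≤ z + y
    *-nonneg        : ∀ {x y} → 0# ≤ x → 0# ≤ y → 0# ≤ x * y

  UpperBound : (ℝ → Set) → ℝ → Set
  UpperBound P b = ∀ x → P x → x ≤ b

  field
    supremum : (P : ℝ → Set) → ∃ P → ∃ (UpperBound P) →
               ∃ λ s → UpperBound P s × (∀ b → UpperBound P b → s ≤ b)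

  open IsDecTotalOrder isDecTotalOrder public
    using (_≟_; _≤?_; total; antisym; isTotalOrder; ≤-respʳ-≈; ≤-respˡ-≈)
    renaming (refl to ≤-refl; reflexive to ≤-reflexive; trans to ≤-trans)

  totalOrder : TotalOrder 0ℓ 0ℓ 0ℓ
  totalOrder = record { isTotalOrder = isTotalOrder }

  open ToStrict _≈_ _≤_ public using (_<_)
  open Max totalOrder public using (_⊔_; x≤x⊔y; x≤y⊔x)

module RealOps (R : RealField) where
  open RealField R public
  open Exp semiring public using (_^_)
  open Mult semiring public using () renaming (_×_ to _·ℕ_)
  open RingProperties ring
  open SetoidReasoning setoid

  infix  8 _⁻¹
  infixl 7 _/_

  fromℕ : ℕ → ℝ
  fromℕ k = k ·ℕ 1#

  -- Total inverse, with 0 ⁻¹ = 0.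
  _⁻¹ : ℝ → ℝ
  x ⁻¹ with x ≟ 0#
  ... | yes _   = 0#
  ... | no  x≉0 = proj₁ (inverse x x≉0)

  _/_ : ℝ → ℝ → ℝ
  x / y = x * y ⁻¹

  ⁻¹-inverseʳ : ∀ x → x ≉ 0# → x * x ⁻¹ ≈ 1#
  ⁻¹-inverseʳ x x≉0 with x ≟ 0#
  ... | yes x≈0  = contradiction x≈0 x≉0
  ... | no  x≉0′ = proj₂ (inverse x x≉0′)

  ⁻¹-inverseˡ : ∀ x → x ≉ 0# → x ⁻¹ * x ≈ 1#
  ⁻¹-inverseˡ x x≉0 = trans (*-comm _ _) (⁻¹-inverseʳ x x≉0)

  x*y≈0⇒y≈0 : ∀ {x y} → x ≉ 0# → x * y ≈ 0# → y ≈ 0#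
  x*y≈0⇒y≈0 {x} {y} x≉0 xy≈0 = begin
    y               ≈⟨ *-identityˡ y ⟨
    1# * y          ≈⟨ *-congʳ (⁻¹-inverseˡ x x≉0) ⟨
    x ⁻¹ * x * y    ≈⟨ *-assoc _ _ _ ⟩
    x ⁻¹ * (x * y)  ≈⟨ *-congˡ xy≈0 ⟩
    x ⁻¹ * 0#       ≈⟨ zeroʳ _ ⟩
    0#              ∎

  x*x≈0⇒x≈0 : ∀ {x} → x * x ≈ 0# → x ≈ 0#
  x*x≈0⇒x≈0 {x} xx≈0 with x ≟ 0#
  ... | yes x≈0 = x≈0
  ... | no  x≉0 = contradiction (x*y≈0⇒y≈0 x≉0 xx≈0) x≉0

  +-nonneg : ∀ {x y} → 0# ≤ x → 0# ≤ y → 0# ≤ x + y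
  +-nonneg {x} 0≤x 0≤y =
    ≤-trans (≤-trans 0≤x (≤-reflexive (sym (+-identityʳ x)))) (+-monoˡ-≤ x 0≤y)

  x≤y⇒0≤y-x : ∀ {x y} → x ≤ y → 0# ≤ y - x
  x≤y⇒0≤y-x {x} {y} x≤y = ≤-respˡ-≈ (-‿inverseˡ x)
    (≤-respʳ-≈ (+-comm _ _) (+-monoˡ-≤ (- x) x≤y))

  0≤y-x⇒x≤y : ∀ {x y} → 0# ≤ y - x → x ≤ y
  0≤y-x⇒x≤y {x} {y} 0≤y-x = ≤-respˡ-≈ (+-identityʳ x) (≤-respʳ-≈ lem (+-monoˡ-≤ x 0≤y-x))
    where
    lem : x + (y - x) ≈ y
    lem = begin
      x + (y - x)    ≈⟨ +-congˡ (+-comm _ _) ⟩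
      x + (- x + y)  ≈⟨ +-assoc _ _ _ ⟨
      x - x + y      ≈⟨ +-congʳ (-‿inverseʳ x) ⟩
      0# + y         ≈⟨ +-identityˡ y ⟩
      y              ∎

  x*x-nonneg : ∀ x → 0# ≤ x * x
  x*x-nonneg x with total 0# x
  ... | inj₁ 0≤x = *-nonneg 0≤x 0≤x
  ... | inj₂ x≤0 = ≤-respʳ-≈ lem (*-nonneg 0≤-x 0≤-x)
    where
    0≤-x : 0# ≤ - x
    0≤-x = ≤-respʳ-≈ (+-identityˡ _) (x≤y⇒0≤y-x x≤0)
    lem : - x * - x ≈ x * x
    lem = begin
      - x * - x      ≈⟨ -‿distribˡ-* x (- x) ⟨
      - (x * - x)    ≈⟨ -‿cong (-‿distribʳ-* x x) ⟨
      - (- (x * x))  ≈⟨ -‿involutive (x * x) ⟩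
      x * x          ∎

  0≤1 : 0# ≤ 1#
  0≤1 = ≤-respʳ-≈ (*-identityˡ 1#) (x*x-nonneg 1#)

  ⁻¹-nonneg : ∀ {x} → 0# < x → 0# ≤ x ⁻¹
  ⁻¹-nonneg {x} (0≤x , 0≉x) = ≤-respʳ-≈ lem (*-nonneg 0≤x (x*x-nonneg (x ⁻¹)))
    where
    lem : x * (x ⁻¹ * x ⁻¹) ≈ x ⁻¹
    lem = begin
      x * (x ⁻¹ * x ⁻¹)  ≈⟨ *-assoc _ _ _ ⟨
      x * x ⁻¹ * x ⁻¹    ≈⟨ *-congʳ (⁻¹-inverseʳ x (0≉x ∘ sym)) ⟩
      1# * x ⁻¹          ≈⟨ *-identityˡ _ ⟩
      x ⁻¹               ∎

  0≤x+y≈0⇒x≈0 : ∀ {x y} → 0# ≤ x → 0# ≤ y → x + y ≈ 0# → x ≈ 0#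
  0≤x+y≈0⇒x≈0 {x} {y} 0≤x 0≤y x+y≈0 = antisym
    (≤-respˡ-≈ (+-identityʳ x) (≤-respʳ-≈ x+y≈0 (+-monoˡ-≤ x 0≤y))) 0≤x

  -- √ a = sup { x ∣ x² ≤ max(a,0) }, which is the usual square root for
  -- a ≥ 0 and is 0 for a < 0.
  √-Set : ℝ → ℝ → Set
  √-Set a x = x * x ≤ a ⊔ 0#

  √-Set-nonempty : ∀ a → ∃ (√-Set a)
  √-Set-nonempty a = 0# , ≤-respˡ-≈ (sym (zeroˡ 0#)) (x≤y⊔x a 0#)

  √-Set-bounded : ∀ a → ∃ (UpperBound (√-Set a))
  √-Set-bounded a = 1# + b , bound
    where
    b = a ⊔ 0#
    bound : UpperBound (√-Set a) (1# + b)
    bound x xx≤b with total x 1#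
    ... | inj₁ x≤1 = ≤-trans x≤1 (≤-respˡ-≈ (+-identityʳ 1#) (+-monoˡ-≤ 1# (x≤y⊔x a 0#)))
    ... | inj₂ 1≤x = ≤-trans x≤xx (≤-trans xx≤b b≤1+b)
      where
      x≤xx : x ≤ x * x
      x≤xx = 0≤y-x⇒x≤y (≤-respʳ-≈
        (begin
          x * (x - 1#)        ≈⟨ distribˡ x x (- 1#) ⟩
          x * x + x * - 1#    ≈⟨ +-congˡ (-‿distribʳ-* x 1#) ⟨
          x * x - x * 1#      ≈⟨ +-congˡ (-‿cong (*-identityʳ x)) ⟩
          x * x - x           ∎)
        (*-nonneg (≤-trans 0≤1 1≤x) (x≤y⇒0≤y-x 1≤x)))
      b≤1+b : b ≤ 1# + b
      b≤1+b = ≤-respˡ-≈ (+-identityʳ b) (≤-respʳ-≈ (+-comm b 1#) (+-monoˡ-≤ b 0≤1))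

  √ : ℝ → ℝ
  √ a = proj₁ (supremum (√-Set a) (√-Set-nonempty a) (√-Set-bounded a))

module LinearAlgebra (R : RealField) where
  open RealOps R public
  open Sum semiring public
    using (sum; sum-syntax; sum-cong-≋; sum-replicate-zero; ∑-distrib-+; ∑-comm;
           *-distribˡ-sum; *-distribʳ-sum)
  open RingProperties ring
  open SetoidReasoning setoid

  Matrix : ℕ → ℕ → Set
  Matrix m n = Fin m → Fin n → ℝ

  infix  4 _≋_ _≋ₘ_
  infixl 6 _⊕_ _⊖_ _⊞_
  infixl 7 _⊙_ _⊡_ _⊗_
  infixr 8 _*ᵥ_
  infix  9 _ᵀ

  private
    variable
      l m n : ℕ

  _≋_ : Rel (Vector ℝ n) 0ℓ
  u ≋ v = ∀ i → u i ≈ v i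

  _≋ₘ_ : Rel (Matrix m n) 0ℓ
  A ≋ₘ B = ∀ i j → A i j ≈ B i j

  0ᵥ : Vector ℝ n
  0ᵥ _ = 0#

  _⊕_ _⊖_ : Vector ℝ n → Vector ℝ n → Vector ℝ n
  (u ⊕ v) i = u i + v i
  (u ⊖ v) i = u i - v i

  _⊙_ : ℝ → Vector ℝ n → Vector ℝ n
  (a ⊙ v) i = a * v i

  ⟨_,_⟩ : Vector ℝ n → Vector ℝ n → ℝ
  ⟨ u , v ⟩ = sum λ i → u i * v i

  ∥_∥₂ : Vector ℝ n → ℝ
  ∥ v ∥₂ = √ (sum λ i → v i ^ 2)

  Id : Matrix n n
  Id i j = if does (i Fin.≟ j) then 1# else 0#

  _ᵀ : Matrix m n → Matrix n m
  (A ᵀ) i j = A j i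

  _⊞_ : Matrix m n → Matrix m n → Matrix m n
  (A ⊞ B) i j = A i j + B i j

  _⊡_ : ℝ → Matrix m n → Matrix m n
  (a ⊡ A) i j = a * A i j

  _⊗_ : Matrix l m → Matrix m n → Matrix l n
  (A ⊗ B) i k = sum λ j → A i j * B j k

  _*ᵥ_ : Matrix m n → Vector ℝ n → Vector ℝ m
  (A *ᵥ x) i = sum λ j → A i j * x j

  ∥_∥²[_] : Vector ℝ n → Matrix n n → ℝ
  ∥ u ∥²[ H ] = ⟨ u , H *ᵥ u ⟩

  IsInverse : Matrix n n → Matrix n n → Set
  IsInverse A B = (A ⊗ B ≋ₘ Id) × (B ⊗ A ≋ₘ Id)

  TrivialKernel : Matrix m n → Set
  TrivialKernel A = ∀ x → A *ᵥ x ≋ 0ᵥ → x ≋ 0ᵥ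

  sum-zero : {v : Vector ℝ n} → v ≋ 0ᵥ → sum v ≈ 0#
  sum-zero {n} v≋0 = trans (sum-cong-≋ v≋0) (sum-replicate-zero n)

  sum-neg : (v : Vector ℝ n) → sum (λ i → - v i) ≈ - sum v
  sum-neg v = begin
    sum (λ i → - v i)       ≈⟨ sum-cong-≋ (λ i → sym (-1*x≈-x (v i))) ⟩
    sum (λ i → - 1# * v i)  ≈⟨ *-distribˡ-sum (- 1#) v ⟨
    - 1# * sum v            ≈⟨ -1*x≈-x (sum v) ⟩
    - sum v                 ∎

  sum-sub : (u v : Vector ℝ n) → sum (u ⊖ v) ≈ sum u - sum v
  sum-sub u v = trans (∑-distrib-+ u (λ i → - v i)) (+-congˡ (sum-neg v))

  sum-nonneg : {v : Vector ℝ n} → (∀ i → 0# ≤ v i) → 0# ≤ sum v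
  sum-nonneg {zero}  0≤v = ≤-refl
  sum-nonneg {suc n} 0≤v = +-nonneg (0≤v zero) (sum-nonneg (0≤v ∘ suc))

  sum≈0⇒≋0 : {v : Vector ℝ n} → (∀ i → 0# ≤ v i) → sum v ≈ 0# → v ≋ 0ᵥ
  sum≈0⇒≋0 0≤v s zero    = 0≤x+y≈0⇒x≈0 (0≤v zero) (sum-nonneg (0≤v ∘ suc)) s
  sum≈0⇒≋0 0≤v s (suc i) = sum≈0⇒≋0 (0≤v ∘ suc)
    (0≤x+y≈0⇒x≈0 (sum-nonneg (0≤v ∘ suc)) (0≤v zero) (trans (+-comm _ _) s)) i

  ⟨v,v⟩-nonneg : (v : Vector ℝ n) → 0# ≤ ⟨ v , v ⟩
  ⟨v,v⟩-nonneg v = sum-nonneg (λ i → x*x-nonneg (v i))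

  ⟨v,v⟩≈0⇒v≋0 : (v : Vector ℝ n) → ⟨ v , v ⟩ ≈ 0# → v ≋ 0ᵥ
  ⟨v,v⟩≈0⇒v≋0 v s i = x*x≈0⇒x≈0 (sum≈0⇒≋0 (λ j → x*x-nonneg (v j)) s i)

  Id-*ᵥ : (v : Vector ℝ n) → Id *ᵥ v ≋ v
  Id-*ᵥ v zero    = trans (+-cong (*-identityˡ _) (sum-zero (λ j → zeroˡ (v (suc j)))))
                          (+-identityʳ _)
  Id-*ᵥ v (suc i) = trans (+-cong (zeroˡ _) (Id-*ᵥ (v ∘ suc) i)) (+-identityˡ _)

  Id-sym : (i j : Fin n) → Id i j ≡ Id j i
  Id-sym zero    zero    = ≡.refl
  Id-sym zero    (suc j) = ≡.refl
  Id-sym (suc i) zero    = ≡.refl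
  Id-sym (suc i) (suc j) = Id-sym i j

  ⊗-*ᵥ : (A : Matrix l m) (B : Matrix m n) (x : Vector ℝ n) → (A ⊗ B) *ᵥ x ≋ A *ᵥ (B *ᵥ x)
  ⊗-*ᵥ A B x i = begin
    sum (λ k → sum (λ j → A i j * B j k) * x k)
      ≈⟨ sum-cong-≋ (λ k → *-distribʳ-sum (x k) (λ j → A i j * B j k)) ⟩
    sum (λ k → sum (λ j → A i j * B j k * x k))
      ≈⟨ ∑-comm (λ k j → A i j * B j k * x k) ⟩
    sum (λ j → sum (λ k → A i j * B j k * x k))
      ≈⟨ sum-cong-≋ (λ j → sum-cong-≋ (λ k → *-assoc (A i j) (B j k) (x k))) ⟩
    sum (λ j → sum (λ k → A i j * (B j k * x k)))
      ≈⟨ sum-cong-≋ (λ j → *-distribˡ-sum (A i j) (λ k → B j k * x k)) ⟨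
    sum (λ j → A i j * sum (λ k → B j k * x k)) ∎

  ⟨x,Aᵀy⟩≈⟨Ax,y⟩ : (A : Matrix m n) (x : Vector ℝ n) (y : Vector ℝ m) →
                   ⟨ x , A ᵀ *ᵥ y ⟩ ≈ ⟨ A *ᵥ x , y ⟩
  ⟨x,Aᵀy⟩≈⟨Ax,y⟩ A x y = begin
    sum (λ j → x j * sum (λ i → A i j * y i))
      ≈⟨ sum-cong-≋ (λ j → *-distribˡ-sum (x j) (λ i → A i j * y i)) ⟩
    sum (λ j → sum (λ i → x j * (A i j * y i)))
      ≈⟨ ∑-comm (λ j i → x j * (A i j * y i)) ⟩
    sum (λ i → sum (λ j → x j * (A i j * y i)))
      ≈⟨ sum-cong-≋ (λ i → sum-cong-≋ (λ j →
           trans (sym (*-assoc (x j) (A i j) (y i))) (*-congʳ (*-comm (x j) (A i j))))) ⟩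
    sum (λ i → sum (λ j → A i j * x j * y i))
      ≈⟨ sum-cong-≋ (λ i → *-distribʳ-sum (y i) (λ j → A i j * x j)) ⟨
    sum (λ i → sum (λ j → A i j * x j) * y i) ∎

  -- A matrix with trivial kernel has a left inverse, by Gaussian elimination
  -- on the first column with pivot A r 0.
  leftInverse : (A : Matrix m n) → TrivialKernel A → ∃ λ (B : Matrix n m) → B ⊗ A ≋ₘ Id
  leftInverse {m} {zero}  A ker = (λ ()) , λ ()
  leftInverse {m} {suc n} A ker = B , B⊗A
    where
    col₀≢0 : ¬ (∀ i → A i zero ≈ 0#)
    col₀≢0 col₀≈0 = 0≉1 (sym (ker (1# ∷ 0ᵥ) A*e₀≈0 zero))
      where
      A*e₀≈0 : A *ᵥ (1# ∷ 0ᵥ) ≋ 0ᵥ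
      A*e₀≈0 i = trans
        (+-cong (trans (*-identityʳ _) (col₀≈0 i)) (sum-zero (λ j → zeroʳ (A i (suc j)))))
        (+-identityʳ 0#)

    pivot : ∃ λ i → A i zero ≉ 0#
    pivot = ¬∀⟶∃¬ m (λ i → A i zero ≈ 0#) (λ i → A i zero ≟ 0#) col₀≢0

    r : Fin m
    r = proj₁ pivot

    q : ℝ
    q = A r zero ⁻¹

    q*p≈1 : q * A r zero ≈ 1#
    q*p≈1 = ⁻¹-inverseˡ (A r zero) (proj₂ pivot)

    A′ : Matrix m n
    A′ i j = A i (suc j) - A i zero * (q * A r (suc j))

    ker′ : TrivialKernel A′
    ker′ y A′y≈0 j = ker (- (q * s) ∷ y) A*cy≈0 (suc j)
      where
      s = sum λ j → A r (suc j) * y j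
      A*cy≈0 : A *ᵥ (- (q * s) ∷ y) ≋ 0ᵥ
      A*cy≈0 i = begin
        a * - (q * s) + sum (λ j → A i (suc j) * y j)
          ≈⟨ +-comm _ _ ⟩
        sum (λ j → A i (suc j) * y j) + a * - (q * s)
          ≈⟨ +-congˡ (-‿distribʳ-* a (q * s)) ⟨
        sum (λ j → A i (suc j) * y j) - a * (q * s)
          ≈⟨ +-congˡ (-‿cong (trans (sym (*-assoc a q s)) (*-distribˡ-sum (a * q) (λ j → A r (suc j) * y j)))) ⟩
        sum (λ j → A i (suc j) * y j) - sum (λ j → a * q * (A r (suc j) * y j))
          ≈⟨ sum-sub (λ j → A i (suc j) * y j) (λ j → a * q * (A r (suc j) * y j)) ⟨
        sum (λ j → A i (suc j) * y j - a * q * (A r (suc j) * y j))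
          ≈⟨ sum-cong-≋ (λ j → +-congˡ (-‿cong
               (trans (sym (*-assoc (a * q) (A r (suc j)) (y j))) (*-congʳ (*-assoc a q (A r (suc j))))))) ⟩
        sum (λ j → A i (suc j) * y j - a * (q * A r (suc j)) * y j)
          ≈⟨ sum-cong-≋ (λ j → [y-z]x≈yx-zx (y j) (A i (suc j)) (a * (q * A r (suc j)))) ⟨
        sum (λ j → A′ i j * y j)
          ≈⟨ A′y≈0 i ⟩
        0# ∎
        where a = A i zero

    B′ : Matrix n m
    B′ = proj₁ (leftInverse A′ ker′)

    B′⊗A′ : B′ ⊗ A′ ≋ₘ Id
    B′⊗A′ = proj₂ (leftInverse A′ ker′)

    w : Vector ℝ n
    w j = sum λ i → B′ j i * A i zero

    C : Matrix n m
    C j i = B′ j i - w j * q * Id r i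

    b₀ : Vector ℝ m
    b₀ i = q * (Id r i - sum (λ j → A r (suc j) * C j i))

    B : Matrix (suc n) m
    B = b₀ ∷ C

    C-apply : ∀ j (v : Vector ℝ m) →
              sum (λ i → C j i * v i) ≈ sum (λ i → B′ j i * v i) - w j * q * v r
    C-apply j v = begin
      sum (λ i → (B′ j i - w j * q * Id r i) * v i)
        ≈⟨ sum-cong-≋ (λ i → [y-z]x≈yx-zx (v i) (B′ j i) (w j * q * Id r i)) ⟩
      sum (λ i → B′ j i * v i - w j * q * Id r i * v i)
        ≈⟨ sum-sub (λ i → B′ j i * v i) (λ i → w j * q * Id r i * v i) ⟩
      sum (λ i → B′ j i * v i) - sum (λ i → w j * q * Id r i * v i)
        ≈⟨ +-congˡ (-‿cong (sum-cong-≋ (λ i → *-assoc (w j * q) (Id r i) (v i)))) ⟩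
      sum (λ i → B′ j i * v i) - sum (λ i → w j * q * (Id r i * v i))
        ≈⟨ +-congˡ (-‿cong (*-distribˡ-sum (w j * q) (λ i → Id r i * v i))) ⟨
      sum (λ i → B′ j i * v i) - w j * q * sum (λ i → Id r i * v i)
        ≈⟨ +-congˡ (-‿cong (*-congˡ (Id-*ᵥ v r))) ⟩
      sum (λ i → B′ j i * v i) - w j * q * v r ∎

    b₀-apply : ∀ (v : Vector ℝ m) →
               sum (λ i → b₀ i * v i) ≈ q * (v r - sum (λ j → A r (suc j) * sum (λ i → C j i * v i)))
    b₀-apply v = begin
      sum (λ i → q * (Id r i - g i) * v i)
        ≈⟨ sum-cong-≋ (λ i → *-assoc q (Id r i - g i) (v i)) ⟩
      sum (λ i → q * ((Id r i - g i) * v i))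
        ≈⟨ *-distribˡ-sum q (λ i → (Id r i - g i) * v i) ⟨
      q * sum (λ i → (Id r i - g i) * v i)
        ≈⟨ *-congˡ (sum-cong-≋ (λ i → [y-z]x≈yx-zx (v i) (Id r i) (g i))) ⟩
      q * sum (λ i → Id r i * v i - g i * v i)
        ≈⟨ *-congˡ (sum-sub (λ i → Id r i * v i) (λ i → g i * v i)) ⟩
      q * (sum (λ i → Id r i * v i) - sum (λ i → g i * v i))
        ≈⟨ *-congˡ (+-cong (Id-*ᵥ v r) (-‿cong (⊗-*ᵥ (λ (_ : Fin 1) j → A r (suc j)) C v zero))) ⟩
      q * (v r - sum (λ j → A r (suc j) * sum (λ i → C j i * v i))) ∎
      where
      g : Vector ℝ m
      g i = sum λ j → A r (suc j) * C j i

    C-col₀ : ∀ j → sum (λ i → C j i * A i zero) ≈ 0#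
    C-col₀ j = begin
      sum (λ i → C j i * A i zero)  ≈⟨ C-apply j (λ i → A i zero) ⟩
      w j - w j * q * A r zero      ≈⟨ +-congˡ (-‿cong (*-assoc _ _ _)) ⟩
      w j - w j * (q * A r zero)    ≈⟨ +-congˡ (-‿cong (trans (*-congˡ q*p≈1) (*-identityʳ _))) ⟩
      w j - w j                     ≈⟨ -‿inverseʳ (w j) ⟩
      0#                            ∎

    C-cols : ∀ j l → sum (λ i → C j i * A i (suc l)) ≈ Id j l
    C-cols j l = begin
      sum (λ i → C j i * A i (suc l))
        ≈⟨ C-apply j (λ i → A i (suc l)) ⟩
      sum (λ i → B′ j i * A i (suc l)) - w j * q * A r (suc l)
        ≈⟨ +-congˡ (-‿cong (trans (*-assoc (w j) q (A r (suc l)))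
             (*-distribʳ-sum (q * A r (suc l)) (λ i → B′ j i * A i zero)))) ⟩
      sum (λ i → B′ j i * A i (suc l)) - sum (λ i → B′ j i * A i zero * (q * A r (suc l)))
        ≈⟨ sum-sub (λ i → B′ j i * A i (suc l)) (λ i → B′ j i * A i zero * (q * A r (suc l))) ⟨
      sum (λ i → B′ j i * A i (suc l) - B′ j i * A i zero * (q * A r (suc l)))
        ≈⟨ sum-cong-≋ (λ i → +-congˡ (-‿cong (*-assoc (B′ j i) (A i zero) (q * A r (suc l))))) ⟩
      sum (λ i → B′ j i * A i (suc l) - B′ j i * (A i zero * (q * A r (suc l))))
        ≈⟨ sum-cong-≋ (λ i → x[y-z]≈xy-xz (B′ j i) (A i (suc l)) (A i zero * (q * A r (suc l)))) ⟨
      sum (λ i → B′ j i * A′ i l)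
        ≈⟨ B′⊗A′ j l ⟩
      Id j l ∎

    B⊗A : B ⊗ A ≋ₘ Id
    B⊗A zero zero = begin
      sum (λ i → b₀ i * A i zero)
        ≈⟨ b₀-apply (λ i → A i zero) ⟩
      q * (A r zero - sum (λ j → A r (suc j) * sum (λ i → C j i * A i zero)))
        ≈⟨ *-congˡ (+-congˡ (-‿cong (sum-zero (λ j → trans (*-congˡ (C-col₀ j)) (zeroʳ _))))) ⟩
      q * (A r zero - 0#)
        ≈⟨ *-congˡ (trans (+-congˡ -0#≈0#) (+-identityʳ _)) ⟩
      q * A r zero
        ≈⟨ q*p≈1 ⟩
      1# ∎
    B⊗A zero (suc l) = begin
      sum (λ i → b₀ i * A i (suc l))
        ≈⟨ b₀-apply (λ i → A i (suc l)) ⟩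
      q * (A r (suc l) - sum (λ j → A r (suc j) * sum (λ i → C j i * A i (suc l))))
        ≈⟨ *-congˡ (+-congˡ (-‿cong (sum-cong-≋ (λ j → trans (*-congˡ
             (trans (C-cols j l) (reflexive (Id-sym j l)))) (*-comm _ _))))) ⟩
      q * (A r (suc l) - sum (λ j → Id l j * A r (suc j)))
        ≈⟨ *-congˡ (+-congˡ (-‿cong (Id-*ᵥ (λ j → A r (suc j)) l))) ⟩
      q * (A r (suc l) - A r (suc l))
        ≈⟨ trans (*-congˡ (-‿inverseʳ _)) (zeroʳ q) ⟩
      0# ∎
    B⊗A (suc j) zero    = C-col₀ j
    B⊗A (suc j) (suc l) = C-cols j l

  symmetricInverse : (A : Matrix n n) → A ᵀ ≋ₘ A → TrivialKernel A → ∃ (IsInverse A)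
  symmetricInverse A Aᵀ≈A ker = B , A⊗B , B⊗A
    where
    B   = proj₁ (leftInverse A ker)
    B⊗A = proj₂ (leftInverse A ker)

    A⊗Bᵀ : A ⊗ B ᵀ ≋ₘ Id
    A⊗Bᵀ i k = begin
      sum (λ j → A i j * B k j)  ≈⟨ sum-cong-≋ (λ j → trans (*-comm _ _) (*-congˡ (Aᵀ≈A j i))) ⟩
      sum (λ j → B k j * A j i)  ≈⟨ B⊗A k i ⟩
      Id k i                     ≡⟨ Id-sym k i ⟩
      Id i k                     ∎

    Bᵀ≈B : B ᵀ ≋ₘ B
    Bᵀ≈B i k = begin
      (B ᵀ) i k                    ≈⟨ Id-*ᵥ (λ j → B k j) i ⟨
      (Id *ᵥ (λ j → B k j)) i      ≈⟨ sum-cong-≋ (λ j → *-congʳ (B⊗A i j)) ⟨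
      ((B ⊗ A) *ᵥ (λ j → B k j)) i ≈⟨ ⊗-*ᵥ B A (λ j → B k j) i ⟩
      sum (λ l → B i l * (A ⊗ B ᵀ) l k) ≈⟨ sum-cong-≋ (λ l → trans (*-congˡ
                                       (trans (A⊗Bᵀ l k) (reflexive (Id-sym l k)))) (*-comm _ _)) ⟩
      sum (λ l → Id k l * B i l)   ≈⟨ Id-*ᵥ (B i) k ⟩
      B i k                        ∎

    A⊗B : A ⊗ B ≋ₘ Id
    A⊗B i k = trans (sum-cong-≋ (λ j → *-congˡ (sym (Bᵀ≈B j k)))) (A⊗Bᵀ i k)

-- Pixels are numbered from 0, so `toℕ i` is the usual one-based index minus 1.

module Pixels (n : ℕ) .{{_ : NonZero n}} where

  N : ℕ
  N = n ℕ.* n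

  next₁ : Fin N → Fin N
  next₁ i with toℕ i ℕ.<? n ℕ.* (n ℕ.∸ 1)
  ... | yes i< = fromℕ< {toℕ i ℕ.+ n} (ℕ.<-≤-trans (ℕ.+-monoˡ-< n i<) (ℕ.≤-reflexive lem))
    where
    lem : n ℕ.* (n ℕ.∸ 1) ℕ.+ n ≡ N
    lem = ≡.trans (ℕ.+-comm _ n) (≡.trans (≡.sym (ℕ.*-suc n (n ℕ.∸ 1)))
            (≡.cong (n ℕ.*_) (ℕ.suc-pred n)))
  ... | no _   = fromℕ< {toℕ i ℕ.∸ n ℕ.* (n ℕ.∸ 1)}
                   (ℕ.≤-<-trans (ℕ.m∸n≤m (toℕ i) (n ℕ.* (n ℕ.∸ 1))) (toℕ<n i))

  next₂ : Fin N → Fin N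
  next₂ i with n ∣? suc (toℕ i)
  ... | yes _   = fromℕ< {suc (toℕ i) ℕ.∸ n}
                    (ℕ.≤-<-trans (ℕ.∸-monoʳ-≤ (suc (toℕ i)) (ℕ.>-nonZero⁻¹ n)) (toℕ<n i))
  ... | no  n∤ = fromℕ< {suc (toℕ i)}
                    (ℕ.≤∧≢⇒< (toℕ<n i) λ eq → n∤ (≡.subst (n ∣_) (≡.sym eq) (m∣m*n n)))

module Model (R : RealField) where
  open LinearAlgebra R

  module Problem
    (n m : ℕ) .{{_ : NonZero n}} .{{_ : NonZero m}}
    (K : Matrix m (n ℕ.* n)) (f : Vector ℝ m)
    (μ β : ℝ) (0<μ : 0# < μ) (0<β : 0# < β)
    where

    open Pixels n public
    open RingProperties ring
    open SetoidReasoning setoid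

    D⁽¹⁾ D⁽²⁾ : Vector ℝ N → Vector ℝ N
    D⁽¹⁾ x i = x (next₁ i) - x i
    D⁽²⁾ x i = x (next₂ i) - x i

    Dᵢ : Fin N → Vector ℝ N → Vector ℝ 2
    Dᵢ i x = D⁽¹⁾ x i ∷ D⁽²⁾ x i ∷ []

    -- The matrix of x ↦ (D⁽¹⁾x , D⁽²⁾x): its j-th column is the image of the
    -- j-th standard basis vector `Id j`.
    D : Matrix (N ℕ.+ N) N
    D i j = (D⁽¹⁾ (Id j) ++ D⁽²⁾ (Id j)) i

    block : Vector ℝ (N ℕ.+ N) → Fin N → Vector ℝ 2
    block z i = z (i ↑ˡ N) ∷ z (N ↑ʳ i) ∷ []

    Ψ : Vector ℝ N → Vector ℝ (N ℕ.+ N) → ℝ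
    Ψ x z = ∑[ i < N ] ∥ block z i ∥₂
          + β / fromℕ 2 * (∑[ i < N ] (∥ block z i ⊖ Dᵢ i x ∥₂ ^ 2))
          + μ / fromℕ 2 * ∥ K *ᵥ x ⊖ f ∥₂ ^ 2

    IsMinimizer : Vector ℝ N → Vector ℝ (N ℕ.+ N) → Set
    IsMinimizer x* z* = ∀ x z → Ψ x* z* ≤ Ψ x z

    W : Matrix N N
    W = D ᵀ ⊗ D ⊞ (μ / β) ⊡ (K ᵀ ⊗ K)

    KernelsMeetTrivially : Set
    KernelsMeetTrivially = ∀ x → K *ᵥ x ≋ 0ᵥ → D *ᵥ x ≋ 0ᵥ → x ≋ 0ᵥ

    W-symmetric : W ᵀ ≋ₘ W
    W-symmetric i j = +-cong (sum-cong-≋ (λ k → *-comm (D k j) (D k i)))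
                             (*-congˡ (sum-cong-≋ (λ k → *-comm (K k j) (K k i))))

    ⟨x,Wx⟩ : ∀ x → ⟨ x , W *ᵥ x ⟩ ≈ ⟨ D *ᵥ x , D *ᵥ x ⟩ + μ / β * ⟨ K *ᵥ x , K *ᵥ x ⟩
    ⟨x,Wx⟩ x = begin
      sum (λ i → x i * (W *ᵥ x) i)
        ≈⟨ sum-cong-≋ (λ i → *-congˡ (Wx i)) ⟩
      sum (λ i → x i * (DDx i + c * KKx i))
        ≈⟨ sum-cong-≋ (λ i → trans (distribˡ (x i) (DDx i) (c * KKx i)) (+-congˡ (x∙yz≈y∙xz (x i) c (KKx i)))) ⟩
      sum (λ i → x i * DDx i + c * (x i * KKx i))
        ≈⟨ ∑-distrib-+ (λ i → x i * DDx i) (λ i → c * (x i * KKx i)) ⟩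
      ⟨ x , DDx ⟩ + sum (λ i → c * (x i * KKx i))
        ≈⟨ +-congˡ (*-distribˡ-sum c (λ i → x i * KKx i)) ⟨
      ⟨ x , DDx ⟩ + c * ⟨ x , KKx ⟩
        ≈⟨ +-cong (⟨x,Aᵀy⟩≈⟨Ax,y⟩ D x (D *ᵥ x)) (*-congˡ (⟨x,Aᵀy⟩≈⟨Ax,y⟩ K x (K *ᵥ x))) ⟩
      ⟨ D *ᵥ x , D *ᵥ x ⟩ + c * ⟨ K *ᵥ x , K *ᵥ x ⟩ ∎
      where
      open CommutativeSemigroupProperties *-commutativeSemigroup using (x∙yz≈y∙xz)
      c = μ / β
      DDx = D ᵀ *ᵥ (D *ᵥ x)
      KKx = K ᵀ *ᵥ (K *ᵥ x)
      Wx : W *ᵥ x ≋ λ i → DDx i + c * KKx i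
      Wx i = begin
        sum (λ j → ((D ᵀ ⊗ D) i j + c * (K ᵀ ⊗ K) i j) * x j)
          ≈⟨ sum-cong-≋ (λ j → trans (distribʳ (x j) ((D ᵀ ⊗ D) i j) (c * (K ᵀ ⊗ K) i j))
                                     (+-congˡ (*-assoc c ((K ᵀ ⊗ K) i j) (x j)))) ⟩
        sum (λ j → (D ᵀ ⊗ D) i j * x j + c * ((K ᵀ ⊗ K) i j * x j))
          ≈⟨ ∑-distrib-+ (λ j → (D ᵀ ⊗ D) i j * x j) (λ j → c * ((K ᵀ ⊗ K) i j * x j)) ⟩
        ((D ᵀ ⊗ D) *ᵥ x) i + sum (λ j → c * ((K ᵀ ⊗ K) i j * x j))
          ≈⟨ +-congˡ (*-distribˡ-sum c (λ j → (K ᵀ ⊗ K) i j * x j)) ⟨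
        ((D ᵀ ⊗ D) *ᵥ x) i + c * ((K ᵀ ⊗ K) *ᵥ x) i
          ≈⟨ +-cong (⊗-*ᵥ (D ᵀ) D x i) (*-congˡ (⊗-*ᵥ (K ᵀ) K x i)) ⟩
        DDx i + c * KKx i ∎

    W-trivialKernel : KernelsMeetTrivially → TrivialKernel W
    W-trivialKernel ker x Wx≈0 = ker x
      (⟨v,v⟩≈0⇒v≋0 (K *ᵥ x) (x*y≈0⇒y≈0 c≉0 (0≤x+y≈0⇒x≈0 0≤cKK 0≤DD (trans (+-comm _ _) total≈0))))
      (⟨v,v⟩≈0⇒v≋0 (D *ᵥ x) (0≤x+y≈0⇒x≈0 0≤DD 0≤cKK total≈0))
      where
      c = μ / β
      0≤DD  = ⟨v,v⟩-nonneg (D *ᵥ x)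
      0≤cKK = *-nonneg (*-nonneg (proj₁ 0<μ) (⁻¹-nonneg 0<β)) (⟨v,v⟩-nonneg (K *ᵥ x))
      total≈0 : ⟨ D *ᵥ x , D *ᵥ x ⟩ + c * ⟨ K *ᵥ x , K *ᵥ x ⟩ ≈ 0#
      total≈0 = trans (sym (⟨x,Wx⟩ x)) (sum-zero (λ i → trans (*-congˡ (Wx≈0 i)) (zeroʳ _)))
      c≉0 : c ≉ 0#
      c≉0 c≈0 = 0≉1 (begin
        0#           ≈⟨ zeroʳ β ⟨
        β * 0#       ≈⟨ *-congˡ (x*y≈0⇒y≈0 (proj₂ 0<μ ∘ sym) c≈0) ⟨
        β * β ⁻¹     ≈⟨ ⁻¹-inverseʳ β (proj₂ 0<β ∘ sym) ⟩
        1#           ∎)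

    W-invertible : KernelsMeetTrivially → ∃ (IsInverse W)
    W-invertible ker = symmetricInverse W W-symmetric (W-trivialKernel ker)

    W⁻¹ : KernelsMeetTrivially → Matrix N N
    W⁻¹ ker = proj₁ (W-invertible ker)

    Q : KernelsMeetTrivially → Matrix (N ℕ.+ N) (N ℕ.+ N)
    Q ker = Id ⊞ D ⊗ W⁻¹ ker ⊗ D ᵀ

    SolvesW : Vector ℝ N → Vector ℝ (N ℕ.+ N) → Set
    SolvesW x z = W *ᵥ x ≋ D ᵀ *ᵥ z ⊕ (μ / β) ⊙ (K ᵀ *ᵥ f)

    -- Only z is meaningful at index 0; the other sequences start at index 1.
    -- In z-step the convention 0·(0/0) = 0 is automatic because y / 0# = 0#.
    record Algorithm2
      (x̄ x : ℕ → Vector ℝ N) (z ẑ : ℕ → Vector ℝ (N ℕ.+ N)) (t : ℕ → ℝ) : Set where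
      field
        ẑ-init : ẑ 1 ≋ z 0
        t-init : t 1 ≈ 1#
        x̄-step : ∀ k → 1 ℕ.≤ k → SolvesW (x̄ k) (ẑ k)
        z-step : ∀ k → 1 ℕ.≤ k → ∀ i → block (z k) i ≋ λ j →
                 ((∥ Dᵢ i (x̄ k) ∥₂ - 1# / β) ⊔ 0#) * (Dᵢ i (x̄ k) j / ∥ Dᵢ i (x̄ k) ∥₂)
        x-step : ∀ k → 1 ℕ.≤ k → SolvesW (x k) (z k)
        t-step : ∀ k → 1 ℕ.≤ k →
                 t (suc k) ≈ (1# + √ (1# + fromℕ 4 * t k ^ 2)) / fromℕ 2
        ẑ-step : ∀ k → 1 ℕ.≤ k →
                 ẑ (suc k) ≋ z k ⊕ ((t k - 1#) / t (suc k)) ⊙ (z k ⊖ z (k ℕ.∸ 1))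

{-# OPTIONS --safe #-}

-- Eliminating x by its normal equations leaves the function
-- F z = Σ ∥zᵢ∥₂ + minₓ (β/2 ∥z - Dx∥² + μ/2 ∥Kx - f∥²), whose smooth part has a
-- β-Lipschitz gradient z ↦ β (z - Dx(z)); Algorithm 2 is FISTA with step 1/β for F.
-- One step satisfies, for all (x′, w),
--   Ψ(xᵏ,zᵏ) + β/2 ∥w - zᵏ∥² ≤ Ψ(x′,w) + β/2 ∥w - ẑᵏ∥².
-- With u_k = t_k zᵏ - (t_k - 1) z^{k-1} - z*, taking w = z^{k-1} with weight t_k² - t_k = t_{k-1}²
-- and w = z* with weight t_k makes the energy
--   t_k² (Ψ(xᵏ,zᵏ) - Ψ(x*,z*)) + β/2 ∥u_k∥²
-- nonincreasing, bounded by β/2 ∥z⁰ - z*∥².  Then t_k ≥ (k+1)/2 and I ≤ Q give the rate.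

module Submission where

open import Defs
import Algebra.Construct.NaturalChoice.Max as Max
import Algebra.Properties.Ring as RingProperties
import Algebra.Properties.Semiring.Mult as Mult
import Algebra.Solver.Ring as RingSolver
open import Algebra.Solver.Ring.AlmostCommutativeRing using (fromCommutativeRing; _-Raw-AlmostCommutative⟶_)
open import Data.Fin.Base using (Fin; zero; suc; _↑ˡ_; _↑ʳ_)
open import Data.Integer.Base as ℤ using (ℤ; +_; -[1+_])
import Data.Integer.Properties as ℤ
open import Data.Maybe.Base using (Maybe; just; nothing)
open import Data.Nat.Base as ℕ using (ℕ; zero; suc; NonZero; s≤s; z≤n)
import Data.Nat.Properties as ℕ
open import Data.Product.Base using (_×_; _,_; proj₁; proj₂)
open import Data.Sum.Base using (inj₁; inj₂)
open import Data.Vec.Functional using (Vector)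
open import Data.Vec.Functional.Properties using (lookup-++ˡ; lookup-++ʳ)
open import Function.Base using (_∘_)
import Relation.Binary.PropositionalEquality.Core as ≡
import Relation.Binary.Reasoning.Setoid as SetoidReasoning
open import Relation.Nullary.Decidable.Core using (yes; no)

-- The smooth part of `F` is never differentiated. Freezing x at x̄ᵏ in the minimum that defines it
-- leaves a quadratic in z with Hessian βI that touches it to first order at ẑᵏ. This is FISTA's
-- upper model, and its minimiser is Dx̄ᵏ, which is why step (2) shrinks Dx̄ᵏ. The one-step
-- inequality is then a sum of three: xᵏ does at least as well as x̄ᵏ for data zᵏ (the model lies
-- above), strong convexity of the proximal problem, and convexity of the smooth part, obtained by
-- completing a square in the normal equations. The real field is given by axioms only, so most
-- inequalities are proved by certificates: the difference of the two sides is written as an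
-- expression that is nonnegative term by term, and a ring solver checks the identity.

-- A ring solver for the reals with integer coefficients

module IntegerSolver (R : RealField) where
  open RealOps R
  open Mult semiring using (×-homo-+; ×1-homo-*)
  open RingProperties ring
  open SetoidReasoning setoid

  -- The cases 0, 1 and n ≥ 2 make `con` agree definitionally with 0#, 1# and fromℕ n.
  fromℤ : ℤ → ℝ
  fromℤ (+ 0)           = 0#
  fromℤ (+ 1)           = 1#
  fromℤ (+ suc (suc n)) = fromℕ (suc (suc n))
  fromℤ -[1+ n ]        = - fromℕ (suc n)

  fromℤ-pos : ∀ n → fromℤ (+ n) ≈ fromℕ n
  fromℤ-pos 0             = refl
  fromℤ-pos 1             = sym (+-identityʳ 1#)
  fromℤ-pos (suc (suc n)) = refl

  fromℤ-neg : ∀ i → fromℤ (ℤ.- i) ≈ - fromℤ i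
  fromℤ-neg (+ 0)       = sym -0#≈0#
  fromℤ-neg (+ suc n)   = -‿cong (sym (fromℤ-pos (suc n)))
  fromℤ-neg (-[1+ n ])  = trans (fromℤ-pos (suc n)) (sym (-‿involutive _))

  fromℤ-⊖ : ∀ m n → fromℤ (m ℤ.⊖ n) ≈ fromℕ m - fromℕ n
  fromℤ-⊖ m       zero    = trans (fromℤ-pos m) (sym (trans (+-congˡ -0#≈0#) (+-identityʳ _)))
  fromℤ-⊖ zero    (suc n) = sym (+-identityˡ _)
  fromℤ-⊖ (suc m) (suc n) = begin
    fromℤ (suc m ℤ.⊖ suc n)                ≡⟨ ≡.cong fromℤ (ℤ.[1+m]⊖[1+n]≡m⊖n m n) ⟩
    fromℤ (m ℤ.⊖ n)                        ≈⟨ fromℤ-⊖ m n ⟩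
    a - b                                ≈⟨ +-congʳ (+-identityʳ a) ⟨
    a + 0# - b                           ≈⟨ +-congʳ (+-congˡ (-‿inverseʳ 1#)) ⟨
    a + (1# - 1#) - b                    ≈⟨ +-congʳ (+-assoc _ _ _) ⟨
    a + 1# - 1# - b                      ≈⟨ +-congʳ (+-congʳ (+-comm _ _)) ⟩
    1# + a - 1# - b                      ≈⟨ +-assoc _ _ _ ⟩
    1# + a + (- 1# - b)                  ≈⟨ +-congˡ (-‿+-comm 1# b) ⟩
    1# + a - (1# + b)                    ∎
    where a = fromℕ m
          b = fromℕ n

  fromℤ-+ : ∀ i j → fromℤ (i ℤ.+ j) ≈ fromℤ i + fromℤ j
  fromℤ-+ (+ m)    (+ n)    = begin
    fromℤ (+ (m ℕ.+ n))  ≈⟨ fromℤ-pos (m ℕ.+ n) ⟩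
    fromℕ (m ℕ.+ n)      ≈⟨ ×-homo-+ 1# m n ⟩
    fromℕ m + fromℕ n    ≈⟨ +-cong (fromℤ-pos m) (fromℤ-pos n) ⟨
    fromℤ (+ m) + fromℤ (+ n) ∎
  fromℤ-+ (+ m)    -[1+ n ] = trans (fromℤ-⊖ m (suc n)) (+-congʳ (sym (fromℤ-pos m)))
  fromℤ-+ -[1+ m ] (+ n)    = trans (fromℤ-⊖ n (suc m)) (trans (+-comm _ _) (+-congˡ (sym (fromℤ-pos n))))
  fromℤ-+ -[1+ m ] -[1+ n ] = begin
    - fromℕ (suc (suc (m ℕ.+ n)))        ≡⟨ ≡.cong (λ k → - fromℕ (suc k)) (≡.sym (ℕ.+-suc m n)) ⟩
    - fromℕ (suc m ℕ.+ suc n)            ≈⟨ -‿cong (×-homo-+ 1# (suc m) (suc n)) ⟩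
    - (fromℕ (suc m) + fromℕ (suc n))    ≈⟨ -‿+-comm _ _ ⟨
    - fromℕ (suc m) - fromℕ (suc n)      ∎

  fromℤ-*⁺ : ∀ m j → fromℤ (+ m ℤ.* j) ≈ fromℤ (+ m) * fromℤ j
  fromℤ-*⁺ m (+ n) = begin
    fromℤ (+ m ℤ.* + n)    ≡⟨ ≡.cong fromℤ (ℤ.pos-* m n) ⟨
    fromℤ (+ (m ℕ.* n))    ≈⟨ fromℤ-pos (m ℕ.* n) ⟩
    fromℕ (m ℕ.* n)        ≈⟨ ×1-homo-* m n ⟩
    fromℕ m * fromℕ n      ≈⟨ *-cong (fromℤ-pos m) (fromℤ-pos n) ⟨
    fromℤ (+ m) * fromℤ (+ n) ∎
  fromℤ-*⁺ m -[1+ n ] = begin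
    fromℤ (+ m ℤ.* -[1+ n ])          ≡⟨ ≡.cong fromℤ (≡.sym (ℤ.neg-distribʳ-* (+ m) (+ suc n))) ⟩
    fromℤ (ℤ.- (+ m ℤ.* + suc n))     ≈⟨ fromℤ-neg (+ m ℤ.* + suc n) ⟩
    - fromℤ (+ m ℤ.* + suc n)         ≈⟨ -‿cong (fromℤ-*⁺ m (+ suc n)) ⟩
    - (fromℤ (+ m) * fromℤ (+ suc n)) ≈⟨ -‿distribʳ-* _ _ ⟩
    fromℤ (+ m) * - fromℤ (+ suc n)   ≈⟨ *-congˡ (-‿cong (fromℤ-pos (suc n))) ⟩
    fromℤ (+ m) * fromℤ -[1+ n ]      ∎

  fromℤ-* : ∀ i j → fromℤ (i ℤ.* j) ≈ fromℤ i * fromℤ j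
  fromℤ-* (+ m)    j = fromℤ-*⁺ m j
  fromℤ-* -[1+ m ] j = begin
    fromℤ (-[1+ m ] ℤ.* j)            ≡⟨ ≡.cong fromℤ (≡.sym (ℤ.neg-distribˡ-* (+ suc m) j)) ⟩
    fromℤ (ℤ.- (+ suc m ℤ.* j))       ≈⟨ fromℤ-neg (+ suc m ℤ.* j) ⟩
    - fromℤ (+ suc m ℤ.* j)           ≈⟨ -‿cong (fromℤ-*⁺ (suc m) j) ⟩
    - (fromℤ (+ suc m) * fromℤ j)     ≈⟨ -‿distribˡ-* _ _ ⟩
    - fromℤ (+ suc m) * fromℤ j       ≈⟨ *-congʳ (-‿cong (fromℤ-pos (suc m))) ⟩
    fromℤ -[1+ m ] * fromℤ j          ∎

  -- The coefficients are integers because normalisation has to compute with them, and arithmetic in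
  -- an abstract field does not reduce.
  fromℤ-morphism : ℤ.+-*-rawRing -Raw-AlmostCommutative⟶ fromCommutativeRing commutativeRing
  fromℤ-morphism = record
    { ⟦_⟧    = fromℤ
    ; +-homo = fromℤ-+
    ; *-homo = fromℤ-*
    ; -‿homo = fromℤ-neg
    ; 0-homo = refl
    ; 1-homo = refl
    }

  fromℤ-≟ : ∀ i j → Maybe (fromℤ i ≈ fromℤ j)
  fromℤ-≟ i j with i ℤ.≟ j
  ... | yes i≡j = just (reflexive (≡.cong fromℤ i≡j))
  ... | no  _   = nothing

  open RingSolver ℤ.+-*-rawRing (fromCommutativeRing commutativeRing) fromℤ-morphism fromℤ-≟ public
    using (solve; _:=_; con; _:+_; _:*_; _:-_; :-_)

-- Ordered-field inequalities and the square root

module OrderedField (R : RealField) where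
  open RealOps R
  open Max totalOrder using (x≤y⇒y⊔x≈y; x≤y⇒x⊔y≈y) public
  open IntegerSolver R

  -- The certificate rule: `d` is visibly nonnegative, and `d ≈ y - x` is left to the ring solver.
  ≤-fromNonneg : ∀ {x y d} → 0# ≤ d → d ≈ y - x → x ≤ y
  ≤-fromNonneg 0≤d d≈ = 0≤y-x⇒x≤y (≤-respʳ-≈ d≈ 0≤d)

  +-mono-≤ : ∀ {a b c d} → a ≤ b → c ≤ d → a + c ≤ b + d
  +-mono-≤ {a} {b} {c} {d} a≤b c≤d = ≤-fromNonneg
    (+-nonneg (x≤y⇒0≤y-x a≤b) (x≤y⇒0≤y-x c≤d))
    (solve 4 (λ a b c d → b :- a :+ (d :- c) := b :+ d :- (a :+ c)) refl a b c d)

  *-monoˡ-≤ : ∀ {c a b} → 0# ≤ c → a ≤ b → c * a ≤ c * b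
  *-monoˡ-≤ {c} {a} {b} 0≤c a≤b = ≤-fromNonneg (*-nonneg 0≤c (x≤y⇒0≤y-x a≤b))
    (solve 3 (λ a b c → c :* (b :- a) := c :* b :- c :* a) refl a b c)

  fromℕ-nonneg : ∀ n → 0# ≤ fromℕ n
  fromℕ-nonneg zero    = ≤-refl
  fromℕ-nonneg (suc n) = +-nonneg 0≤1 (fromℕ-nonneg n)

  fromℕ-suc≉0 : ∀ n → fromℕ (suc n) ≉ 0#
  fromℕ-suc≉0 n e = 0≉1 (sym (0≤x+y≈0⇒x≈0 0≤1 (fromℕ-nonneg n) e))

  ½ : ℝ
  ½ = fromℕ 2 ⁻¹

  2*½ : fromℕ 2 * ½ ≈ 1#
  2*½ = ⁻¹-inverseʳ _ (fromℕ-suc≉0 1)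

  0≤½ : 0# ≤ ½
  0≤½ = ⁻¹-nonneg (fromℕ-nonneg 2 , fromℕ-suc≉0 1 ∘ sym)

  double-cancel-≤ : ∀ {x y} → fromℕ 2 * x ≤ fromℕ 2 * y → x ≤ y
  double-cancel-≤ {x} {y} le = ≤-respˡ-≈ (half x) (≤-respʳ-≈ (half y) (*-monoˡ-≤ 0≤½ le))
    where
    half : ∀ x → ½ * (fromℕ 2 * x) ≈ x
    half x = trans (sym (*-assoc _ _ _)) (trans (*-congʳ (trans (*-comm _ _) 2*½)) (*-identityˡ x))

  -- If `y ≤ x`, adding the nonnegative `2y(x - y)` to `y² - x²` gives `-(x - y)²`, so that square
  -- vanishes and `x ≈ y`.
  square-cancel-≤ : ∀ {x y} → 0# ≤ y → x * x ≤ y * y → x ≤ y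
  square-cancel-≤ {x} {y} 0≤y xx≤yy with total x y
  ... | inj₁ x≤y = x≤y
  ... | inj₂ y≤x = 0≤y-x⇒x≤y (≤-reflexive (sym
    (trans (solve 2 (λ x y → y :- x := :- (x :- y)) refl x y)
      (trans (-‿cong (x*x≈0⇒x≈0 (antisym [x-y]²≤0 (x*x-nonneg (x - y))))) -0#≈0#))))
    where
    open RingProperties ring using (-0#≈0#)
    [x-y]²≤0 : (x - y) * (x - y) ≤ 0#
    [x-y]²≤0 = ≤-fromNonneg
      (+-nonneg (x≤y⇒0≤y-x xx≤yy) (*-nonneg (*-nonneg (fromℕ-nonneg 2) 0≤y) (x≤y⇒0≤y-x y≤x)))
      (solve 2 (λ x y → y :* y :- x :* x :+ con (+ 2) :* y :* (x :- y)
         := con (+ 0) :- (x :- y) :* (x :- y)) refl x y)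

  module Sqrt {a : ℝ} (0≤a : 0# ≤ a) where
    private
      s = √ a
      b = a ⊔ 0#
      sup = supremum (√-Set a) (√-Set-nonempty a) (√-Set-bounded a)

      0≤b : 0# ≤ b
      0≤b = x≤y⊔x a 0#

      s-upper : ∀ x → x * x ≤ b → x ≤ s
      s-upper = proj₁ (proj₂ sup)

      s-least : ∀ c → UpperBound (√-Set a) c → s ≤ c
      s-least = proj₂ (proj₂ sup)

      0≤s : 0# ≤ s
      0≤s = s-upper 0# (proj₂ (√-Set-nonempty a))

      -- If s² < b then s + e with e = (b - s²) / (2s + 1 + b) still has square at most b.
      b≤ss : s * s ≤ b → b ≤ s * s
      b≤ss ss≤b = ≤-fromNonneg (*-nonneg (≤-respʳ-≈ (s-[s+e]≈-e s e) (x≤y⇒0≤y-x s+e≤s)) 0≤D)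
          (trans (solve 2 (λ e D → (:- e) :* D := :- (e :* D)) refl e D)
            (trans (-‿cong eD≈) (solve 2 (λ s b → :- (b :- s :* s) := s :* s :- b) refl s b)))
        where
        D = fromℕ 2 * s + (1# + b)
        0≤D : 0# ≤ D
        0≤D = +-nonneg (*-nonneg (fromℕ-nonneg 2) 0≤s) (+-nonneg 0≤1 0≤b)
        D≉0 : D ≉ 0#
        D≉0 D≈0 = 0≉1 (sym (0≤x+y≈0⇒x≈0 0≤1 (+-nonneg 0≤b (*-nonneg (fromℕ-nonneg 2) 0≤s))
          (trans (solve 2 (λ s b → con (+ 1) :+ (b :+ con (+ 2) :* s) := con (+ 2) :* s :+ (con (+ 1) :+ b))
            refl s b) D≈0)))
        e = (b - s * s) * D ⁻¹
        0≤e : 0# ≤ e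
        0≤e = *-nonneg (x≤y⇒0≤y-x ss≤b) (⁻¹-nonneg (0≤D , D≉0 ∘ sym))
        eD≈ : e * D ≈ b - s * s
        eD≈ = trans (*-assoc _ _ _) (trans (*-congˡ (⁻¹-inverseˡ D D≉0)) (*-identityʳ _))
        s+e≤s : s + e ≤ s
        -- Since `e D ≈ b - s²`, the slack `b - (s + e)²` equals `e (1 + b - e)`, and `b - e` equals
        -- `s² + e (2s + b)`; this is why `D` carries the summand `1 + b`.
        s+e≤s = s-upper (s + e) (≤-fromNonneg
          (*-nonneg 0≤e (+-nonneg 0≤1 (+-nonneg (x*x-nonneg s)
            (*-nonneg 0≤e (+-nonneg (*-nonneg (fromℕ-nonneg 2) 0≤s) 0≤b)))))
          (trans (solve 3 (λ s b e → e :* (con (+ 1) :+ (s :* s :+ e :* (con (+ 2) :* s :+ b)))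
              := e :* (con (+ 1) :+ s :* s :- e :+ e :* (con (+ 2) :* s :+ (con (+ 1) :+ b)))) refl s b e)
            (trans (*-congˡ (+-congˡ eD≈))
            (trans (solve 3 (λ s b e → e :* (con (+ 1) :+ s :* s :- e :+ (b :- s :* s))
              := e :* (con (+ 2) :* s :+ (con (+ 1) :+ b)) :- con (+ 2) :* s :* e :- e :* e) refl s b e)
            (trans (+-congʳ (+-congʳ eD≈))
            (solve 3 (λ s b e → b :- s :* s :- con (+ 2) :* s :* e :- e :* e := b :- (s :+ e) :* (s :+ e)) refl s b e))))))
        s-[s+e]≈-e : ∀ s e → s - (s + e) ≈ - e
        s-[s+e]≈-e = solve 2 (λ s e → s :- (s :+ e) := :- e) refl

      -- If s² > b then, by AM-GM, (s + b / s) / 2 is a smaller upper bound.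
      ss≤b : b ≤ s * s → s * s ≤ b
      ss≤b b≤ss with s ≟ 0#
      ... | yes s≈0 = ≤-respˡ-≈ (sym (trans (*-congʳ s≈0) (zeroˡ s))) 0≤b
      ... | no  s≉0 = ≤-respʳ-≈ sq≈b (*-monoˡ-≤ 0≤s s≤q)
        where
        q = b * s ⁻¹
        sq≈b : s * q ≈ b
        sq≈b = trans (solve 3 (λ s b i → s :* (b :* i) := b :* (s :* i)) refl s b (s ⁻¹))
          (trans (*-congˡ (⁻¹-inverseʳ s s≉0)) (*-identityʳ b))
        0≤q : 0# ≤ q
        0≤q = *-nonneg 0≤b (⁻¹-nonneg (0≤s , s≉0 ∘ sym))
        2r≈ : fromℕ 2 * (½ * (s + q)) ≈ s + q
        2r≈ = trans (sym (*-assoc _ _ _)) (trans (*-congʳ 2*½) (*-identityˡ _))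
        upper : UpperBound (√-Set a) (½ * (s + q))
        upper x xx≤b = double-cancel-≤ (≤-respʳ-≈ (sym 2r≈) (square-cancel-≤ (+-nonneg 0≤s 0≤q)
          (≤-fromNonneg (+-nonneg (*-nonneg (fromℕ-nonneg 4) (x≤y⇒0≤y-x xx≤b)) (x*x-nonneg (s - q)))
            (trans (+-congʳ (*-congˡ (+-congʳ (sym sq≈b))))
              (solve 3 (λ s q x → con (+ 4) :* (s :* q :- x :* x) :+ (s :- q) :* (s :- q)
                := (s :+ q) :* (s :+ q) :- con (+ 2) :* x :* (con (+ 2) :* x)) refl s q x)))))
        s≤q : s ≤ q
        s≤q = ≤-fromNonneg (x≤y⇒0≤y-x (≤-respʳ-≈ 2r≈ (*-monoˡ-≤ (fromℕ-nonneg 2) (s-least _ upper))))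
          (solve 2 (λ s q → s :+ q :- con (+ 2) :* s := q :- s) refl s q)

    √-nonneg : 0# ≤ √ a
    √-nonneg = 0≤s

    √-square : √ a * √ a ≈ a
    √-square = trans ss≈b (x≤y⇒y⊔x≈y 0≤a)
      where
      ss≈b : s * s ≈ b
      ss≈b with total (s * s) b
      ... | inj₁ le = antisym le (b≤ss le)
      ... | inj₂ ge = antisym (ss≤b ge) ge

  open Sqrt public

  √-unique : ∀ {a y} → 0# ≤ y → y * y ≈ a → √ a ≈ y
  √-unique {a} {y} 0≤y yy≈a = antisym
    (square-cancel-≤ 0≤y (≤-reflexive (trans (√-square 0≤a) (sym yy≈a))))
    (square-cancel-≤ (√-nonneg 0≤a) (≤-reflexive (trans yy≈a (sym (√-square 0≤a)))))
    where
    0≤a : 0# ≤ a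
    0≤a = ≤-respʳ-≈ yy≈a (x*x-nonneg y)

-- Inner products and Euclidean norms

module InnerProduct (R : RealField) where
  open LinearAlgebra R
  open OrderedField R
  open IntegerSolver R
  open SetoidReasoning setoid

  private
    variable
      m n : ℕ

  ∥_∥² : Vector ℝ n → ℝ
  ∥ v ∥² = ⟨ v , v ⟩

  sum-mono-≤ : {u v : Vector ℝ n} → (∀ i → u i ≤ v i) → sum u ≤ sum v
  sum-mono-≤ {zero}  u≤v = ≤-refl
  sum-mono-≤ {suc n} u≤v = +-mono-≤ (u≤v zero) (sum-mono-≤ (u≤v ∘ suc))

  sum-++ : ∀ m {n} (v : Vector ℝ (m ℕ.+ n)) → sum v ≈ sum (λ i → v (i ↑ˡ n)) + sum (λ i → v (m ↑ʳ i))
  sum-++ zero    v = sym (+-identityˡ _)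
  sum-++ (suc m) v = trans (+-congˡ (sum-++ m (v ∘ suc))) (sym (+-assoc _ _ _))

  ⟨⟩-cong : {u u′ v v′ : Vector ℝ n} → u ≋ u′ → v ≋ v′ → ⟨ u , v ⟩ ≈ ⟨ u′ , v′ ⟩
  ⟨⟩-cong u≋u′ v≋v′ = sum-cong-≋ (λ i → *-cong (u≋u′ i) (v≋v′ i))

  ⟨⟩-comm : (u v : Vector ℝ n) → ⟨ u , v ⟩ ≈ ⟨ v , u ⟩
  ⟨⟩-comm u v = sum-cong-≋ (λ i → *-comm (u i) (v i))

  ⟨⟩-⊕ˡ : (u v w : Vector ℝ n) → ⟨ u ⊕ v , w ⟩ ≈ ⟨ u , w ⟩ + ⟨ v , w ⟩
  ⟨⟩-⊕ˡ u v w = trans (sum-cong-≋ (λ i → distribʳ (w i) (u i) (v i)))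
    (∑-distrib-+ (λ i → u i * w i) (λ i → v i * w i))

  ⟨⟩-⊖ˡ : (u v w : Vector ℝ n) → ⟨ u ⊖ v , w ⟩ ≈ ⟨ u , w ⟩ - ⟨ v , w ⟩
  ⟨⟩-⊖ˡ u v w = trans
    (sum-cong-≋ (λ i → solve 3 (λ u v w → (u :- v) :* w := u :* w :- v :* w) refl (u i) (v i) (w i)))
    (sum-sub (λ i → u i * w i) (λ i → v i * w i))

  ⟨⟩-⊙ˡ : (a : ℝ) (u v : Vector ℝ n) → ⟨ a ⊙ u , v ⟩ ≈ a * ⟨ u , v ⟩
  ⟨⟩-⊙ˡ a u v = trans (sum-cong-≋ (λ i → *-assoc a (u i) (v i)))
    (sym (*-distribˡ-sum a (λ i → u i * v i)))

  ⟨⟩-⊕ʳ : (u v w : Vector ℝ n) → ⟨ u , v ⊕ w ⟩ ≈ ⟨ u , v ⟩ + ⟨ u , w ⟩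
  ⟨⟩-⊕ʳ u v w = trans (⟨⟩-comm u (v ⊕ w)) (trans (⟨⟩-⊕ˡ v w u) (+-cong (⟨⟩-comm v u) (⟨⟩-comm w u)))

  ⟨⟩-⊖ʳ : (u v w : Vector ℝ n) → ⟨ u , v ⊖ w ⟩ ≈ ⟨ u , v ⟩ - ⟨ u , w ⟩
  ⟨⟩-⊖ʳ u v w = trans (⟨⟩-comm u (v ⊖ w)) (trans (⟨⟩-⊖ˡ v w u) (+-cong (⟨⟩-comm v u) (-‿cong (⟨⟩-comm w u))))

  ⟨⟩-⊙ʳ : (a : ℝ) (u v : Vector ℝ n) → ⟨ u , a ⊙ v ⟩ ≈ a * ⟨ u , v ⟩
  ⟨⟩-⊙ʳ a u v = trans (⟨⟩-comm u (a ⊙ v)) (trans (⟨⟩-⊙ˡ a v u) (*-congˡ (⟨⟩-comm v u)))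

  ∥⊕∥² : (u v : Vector ℝ n) → ∥ u ⊕ v ∥² ≈ ∥ u ∥² + ∥ v ∥² + fromℕ 2 * ⟨ u , v ⟩
  ∥⊕∥² u v = begin
    ∥ u ⊕ v ∥²                               ≈⟨ ⟨⟩-⊕ˡ u v (u ⊕ v) ⟩
    ⟨ u , u ⊕ v ⟩ + ⟨ v , u ⊕ v ⟩            ≈⟨ +-cong (⟨⟩-⊕ʳ u u v) (⟨⟩-⊕ʳ v u v) ⟩
    ∥ u ∥² + ⟨ u , v ⟩ + (⟨ v , u ⟩ + ∥ v ∥²) ≈⟨ +-congˡ (+-congʳ (⟨⟩-comm v u)) ⟩
    ∥ u ∥² + ⟨ u , v ⟩ + (⟨ u , v ⟩ + ∥ v ∥²)
      ≈⟨ solve 3 (λ a b c → a :+ c :+ (c :+ b) := a :+ b :+ con (+ 2) :* c) refl (∥ u ∥²) (∥ v ∥²) ⟨ u , v ⟩ ⟩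
    ∥ u ∥² + ∥ v ∥² + fromℕ 2 * ⟨ u , v ⟩    ∎

  ∥⊖∥² : (u v : Vector ℝ n) → ∥ u ⊖ v ∥² ≈ ∥ u ∥² + ∥ v ∥² - fromℕ 2 * ⟨ u , v ⟩
  ∥⊖∥² u v = begin
    ∥ u ⊖ v ∥²                                ≈⟨ ⟨⟩-⊖ˡ u v (u ⊖ v) ⟩
    ⟨ u , u ⊖ v ⟩ - ⟨ v , u ⊖ v ⟩             ≈⟨ +-cong (⟨⟩-⊖ʳ u u v) (-‿cong (⟨⟩-⊖ʳ v u v)) ⟩
    ∥ u ∥² - ⟨ u , v ⟩ - (⟨ v , u ⟩ - ∥ v ∥²) ≈⟨ +-congˡ (-‿cong (+-congʳ (⟨⟩-comm v u))) ⟩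
    ∥ u ∥² - ⟨ u , v ⟩ - (⟨ u , v ⟩ - ∥ v ∥²)
      ≈⟨ solve 3 (λ a b c → a :- c :- (c :- b) := a :+ b :- con (+ 2) :* c) refl (∥ u ∥²) (∥ v ∥²) ⟨ u , v ⟩ ⟩
    ∥ u ∥² + ∥ v ∥² - fromℕ 2 * ⟨ u , v ⟩     ∎

  ∥⊙∥² : (a : ℝ) (v : Vector ℝ n) → ∥ a ⊙ v ∥² ≈ a * a * ∥ v ∥²
  ∥⊙∥² a v = trans (⟨⟩-⊙ˡ a v (a ⊙ v)) (trans (*-congˡ (⟨⟩-⊙ʳ a v v)) (sym (*-assoc _ _ _)))

  ^2≈* : ∀ x → x ^ 2 ≈ x * x
  ^2≈* x = *-congˡ (*-identityʳ x)

  private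
    ∑v²≈∥v∥² : (v : Vector ℝ n) → (sum λ i → v i ^ 2) ≈ ∥ v ∥²
    ∑v²≈∥v∥² v = sum-cong-≋ (λ i → ^2≈* (v i))

    0≤∑v² : (v : Vector ℝ n) → 0# ≤ (sum λ i → v i ^ 2)
    0≤∑v² v = ≤-respʳ-≈ (sym (∑v²≈∥v∥² v)) (⟨v,v⟩-nonneg v)

  ∥∥₂-nonneg : (v : Vector ℝ n) → 0# ≤ ∥ v ∥₂
  ∥∥₂-nonneg v = √-nonneg (0≤∑v² v)

  ∥∥₂-square : (v : Vector ℝ n) → ∥ v ∥₂ * ∥ v ∥₂ ≈ ∥ v ∥²
  ∥∥₂-square v = trans (√-square (0≤∑v² v)) (∑v²≈∥v∥² v)

  ∥∥₂-unique : (v : Vector ℝ n) {y : ℝ} → 0# ≤ y → y * y ≈ ∥ v ∥² → ∥ v ∥₂ ≈ y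
  ∥∥₂-unique v 0≤y yy≈ = √-unique 0≤y (trans yy≈ (sym (∑v²≈∥v∥² v)))

  *ᵥ-⊖ : (A : Matrix m n) (u v : Vector ℝ n) → A *ᵥ (u ⊖ v) ≋ A *ᵥ u ⊖ A *ᵥ v
  *ᵥ-⊖ A u v i = ⟨⟩-⊖ʳ (A i) u v

  ⊞-*ᵥ : (A B : Matrix m n) (v : Vector ℝ n) → (A ⊞ B) *ᵥ v ≋ A *ᵥ v ⊕ B *ᵥ v
  ⊞-*ᵥ A B v i = ⟨⟩-⊕ˡ (A i) (B i) v

  ⊡-*ᵥ : (a : ℝ) (A : Matrix m n) (v : Vector ℝ n) → (a ⊡ A) *ᵥ v ≋ a ⊙ (A *ᵥ v)
  ⊡-*ᵥ a A v i = ⟨⟩-⊙ˡ a (A i) v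

  -- From 0 ≤ ∥w - ∥w∥ g∥² ≤ 2 ∥w∥ (∥w∥ - ⟨g,w⟩).
  ⟨g,w⟩≤∥w∥₂ : (g w : Vector ℝ n) → ∥ g ∥² ≤ 1# → ⟨ g , w ⟩ ≤ ∥ w ∥₂
  ⟨g,w⟩≤∥w∥₂ g w gg≤1 with ∥ w ∥₂ ≟ 0#
  ... | yes r≈0 = ≤-reflexive (trans
          (sum-zero (λ i → trans
            (*-congˡ (⟨v,v⟩≈0⇒v≋0 w (trans (sym (∥∥₂-square w)) (trans (*-congʳ r≈0) (zeroˡ _))) i))
            (zeroʳ _)))
          (sym r≈0))
  ... | no  r≉0 = double-cancel-≤ (≤-fromNonneg
          (*-nonneg (⁻¹-nonneg (∥∥₂-nonneg w , r≉0 ∘ sym))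
            (+-nonneg (⟨v,v⟩-nonneg (w ⊖ r ⊙ g)) (*-nonneg (x*x-nonneg r) (x≤y⇒0≤y-x gg≤1))))
          (begin
            r ⁻¹ * (∥ w ⊖ r ⊙ g ∥² + r * r * (1# - ∥ g ∥²))
              ≈⟨ *-congˡ (+-congʳ (trans (∥⊖∥² w (r ⊙ g))
                   (+-cong (+-cong (sym (∥∥₂-square w)) (∥⊙∥² r g))
                     (-‿cong (*-congˡ (trans (⟨⟩-⊙ʳ r w g) (*-congˡ (⟨⟩-comm w g)))))))) ⟩
            r ⁻¹ * (r * r + r * r * ∥ g ∥² - fromℕ 2 * (r * ⟨ g , w ⟩) + r * r * (1# - ∥ g ∥²))
              ≈⟨ solve 4 (λ i r G p → i :* (r :* r :+ r :* r :* G :- con (+ 2) :* (r :* p) :+ r :* r :* (con (+ 1) :- G))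
                   := i :* r :* (con (+ 2) :* r :- con (+ 2) :* p)) refl (r ⁻¹) r (∥ g ∥²) ⟨ g , w ⟩ ⟩
            r ⁻¹ * r * (fromℕ 2 * r - fromℕ 2 * ⟨ g , w ⟩)
              ≈⟨ trans (*-congʳ (⁻¹-inverseˡ r r≉0)) (*-identityˡ _) ⟩
            fromℕ 2 * r - fromℕ 2 * ⟨ g , w ⟩ ∎))
    where r = ∥ w ∥₂

-- Shrinkage as a proximal map

module Shrinkage (R : RealField) where
  open LinearAlgebra R
  open OrderedField R
  open IntegerSolver R
  open InnerProduct R
  open SetoidReasoning setoid

  module _ {n} {β : ℝ} (0<β : 0# < β) (p q : Vector ℝ n)
           (q≋ : q ≋ λ j → ((∥ p ∥₂ - 1# / β) ⊔ 0#) * (p j / ∥ p ∥₂)) where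
    private
      r i b : ℝ
      r = ∥ p ∥₂
      i = r ⁻¹
      b = 1# / β

      β≉0 : β ≉ 0#
      β≉0 = proj₂ 0<β ∘ sym

      βb≈1 : β * b ≈ 1#
      βb≈1 = trans (*-congˡ (*-identityˡ _)) (⁻¹-inverseʳ β β≉0)

      0≤r : 0# ≤ r
      0≤r = ∥∥₂-nonneg p

      g : Vector ℝ n
      g = β ⊙ (p ⊖ q)

    -- Together with `⟨g,w⟩≤∥w∥₂`, this makes `g`, the negative gradient of `β/2 ∥· - p∥²` at `q`, a
    -- subgradient of the norm at `q`. Above the threshold `g` is the unit vector `p / ∥p∥` and `q`
    -- is a nonnegative multiple of it; below, `q` vanishes and `g = βp` has norm at most 1.
    shrink-subgradient : ∥ g ∥² ≤ 1# × ⟨ g , q ⟩ ≈ ∥ q ∥₂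
    shrink-subgradient with total b r
    ... | inj₁ b≤r = ≤-reflexive gg≈1 , trans gq≈s (sym qnorm)
      where
      s = r - b

      0≤s : 0# ≤ s
      0≤s = x≤y⇒0≤y-x b≤r

      r≉0 : r ≉ 0#
      r≉0 r≈0 = 0≉1 (begin
        0#      ≈⟨ zeroʳ β ⟨
        β * 0#  ≈⟨ *-congˡ (antisym (*-nonneg 0≤1 (⁻¹-nonneg 0<β)) (≤-respʳ-≈ r≈0 b≤r)) ⟩
        β * b   ≈⟨ βb≈1 ⟩
        1#      ∎)

      ir≈1 : i * r ≈ 1#
      ir≈1 = ⁻¹-inverseˡ r r≉0

      q≋sip : q ≋ (s * i) ⊙ p
      q≋sip j = trans (q≋ j) (trans (*-congʳ (x≤y⇒y⊔x≈y 0≤s))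
        (solve 3 (λ s p i → s :* (p :* i) := s :* i :* p) refl s (p j) i))

      g≋ip : g ≋ i ⊙ p
      g≋ip j = begin
        β * (p j - q j)
          ≈⟨ *-congˡ (+-congˡ (-‿cong (q≋sip j))) ⟩
        β * (p j - (r - b) * i * p j)
          ≈⟨ solve 5 (λ β p r b i → β :* (p :- (r :- b) :* i :* p)
               := β :* p :- i :* r :* (β :* p) :+ β :* b :* (i :* p)) refl β (p j) r b i ⟩
        β * p j - i * r * (β * p j) + β * b * (i * p j)
          ≈⟨ +-cong (+-congˡ (-‿cong (*-congʳ ir≈1))) (*-congʳ βb≈1) ⟩
        β * p j - 1# * (β * p j) + 1# * (i * p j)
          ≈⟨ solve 2 (λ x y → x :- con (+ 1) :* x :+ con (+ 1) :* y := y) refl (β * p j) (i * p j) ⟩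
        i * p j ∎

      scaled : ∀ a c → a * c * ∥ p ∥² ≈ a * r * (c * r)
      scaled a c = trans (*-congˡ (sym (∥∥₂-square p)))
        (solve 3 (λ a c r → a :* c :* (r :* r) := a :* r :* (c :* r)) refl a c r)

      sir≈s : s * i * r ≈ s
      sir≈s = trans (*-assoc _ _ _) (trans (*-congˡ ir≈1) (*-identityʳ s))

      gg≈1 : ∥ g ∥² ≈ 1#
      gg≈1 = trans (⟨⟩-cong g≋ip g≋ip) (trans (∥⊙∥² i p) (trans (scaled i i)
        (trans (*-cong ir≈1 ir≈1) (*-identityˡ 1#))))

      gq≈s : ⟨ g , q ⟩ ≈ s
      gq≈s = begin
        ⟨ g , q ⟩                    ≈⟨ ⟨⟩-cong g≋ip q≋sip ⟩
        ⟨ i ⊙ p , (s * i) ⊙ p ⟩      ≈⟨ trans (⟨⟩-⊙ˡ i p _) (*-congˡ (⟨⟩-⊙ʳ (s * i) p p)) ⟩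
        i * (s * i * ∥ p ∥²)         ≈⟨ *-assoc _ _ _ ⟨
        i * (s * i) * ∥ p ∥²         ≈⟨ scaled i (s * i) ⟩
        i * r * (s * i * r)          ≈⟨ trans (*-cong ir≈1 sir≈s) (*-identityˡ s) ⟩
        s                            ∎

      qnorm : ∥ q ∥₂ ≈ s
      qnorm = ∥∥₂-unique q 0≤s (sym (trans (⟨⟩-cong q≋sip q≋sip) (trans (∥⊙∥² (s * i) p)
        (trans (scaled (s * i) (s * i)) (*-cong sir≈s sir≈s)))))
    ... | inj₂ r≤b = ≤-respˡ-≈ (sym gg≈) [βr]²≤1 , trans gq≈0 (sym qnorm)
      where
      q≋0 : q ≋ 0ᵥ
      q≋0 j = trans (q≋ j) (trans (*-congʳ (x≤y⇒x⊔y≈y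
        (≤-fromNonneg (x≤y⇒0≤y-x r≤b) (solve 2 (λ r b → b :- r := con (+ 0) :- (r :- b)) refl r b)))) (zeroˡ _))

      g≋βp : g ≋ β ⊙ p
      g≋βp j = *-congˡ (trans (+-congˡ (-‿cong (q≋0 j))) (solve 1 (λ x → x :- con (+ 0) := x) refl (p j)))

      gg≈ : ∥ g ∥² ≈ β * r * (β * r)
      gg≈ = trans (⟨⟩-cong g≋βp g≋βp) (trans (∥⊙∥² β p) (trans (*-congˡ (sym (∥∥₂-square p)))
        (solve 2 (λ β r → β :* β :* (r :* r) := β :* r :* (β :* r)) refl β r)))

      βr≤1 : β * r ≤ 1#
      βr≤1 = ≤-respʳ-≈ βb≈1 (*-monoˡ-≤ (proj₁ 0<β) r≤b)

      [βr]²≤1 : β * r * (β * r) ≤ 1#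
      [βr]²≤1 = ≤-trans (≤-respʳ-≈ (*-identityʳ _) (*-monoˡ-≤ (*-nonneg (proj₁ 0<β) 0≤r) βr≤1)) βr≤1

      gq≈0 : ⟨ g , q ⟩ ≈ 0#
      gq≈0 = sum-zero (λ j → trans (*-congˡ (q≋0 j)) (zeroʳ _))

      qnorm : ∥ q ∥₂ ≈ 0#
      qnorm = ∥∥₂-unique q ≤-refl (trans (zeroˡ 0#) (sym (sum-zero (λ j → trans (*-congˡ (q≋0 j)) (zeroʳ _)))))

    -- As `g = 2h (p - q)`, expanding `w - p = (w - q) - (p - q)` turns the claim into
    -- `⟨g,w⟩ ≤ ∥w∥₂`. The term `h ∥w - q∥²` is the gain from strong convexity; it becomes the
    -- distance term on the left of `descent`.
    shrink-prox : ∀ {h} → fromℕ 2 * h ≈ β → (w : Vector ℝ n) →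
      ∥ q ∥₂ + h * ∥ q ⊖ p ∥² + h * ∥ w ⊖ q ∥² ≤ ∥ w ∥₂ + h * ∥ w ⊖ p ∥²
    shrink-prox {h} 2h≈β w = ≤-fromNonneg
      (x≤y⇒0≤y-x (⟨g,w⟩≤∥w∥₂ g w (proj₁ shrink-subgradient)))
      (sym (begin
        ∥ w ∥₂ + h * ∥ w ⊖ p ∥² - (∥ q ∥₂ + h * A + h * B)
          ≈⟨ +-cong (+-congˡ (*-congˡ wp)) (-‿cong (+-congʳ (+-congʳ (sym (proj₂ shrink-subgradient))))) ⟩
        ∥ w ∥₂ + h * (B + A - fromℕ 2 * (X - Y)) - (⟨ g , q ⟩ + h * A + h * B)
          ≈⟨ +-congˡ (-‿cong (+-congʳ (+-congʳ (expand q)))) ⟩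
        ∥ w ∥₂ + h * (B + A - fromℕ 2 * (X - Y)) - (fromℕ 2 * h * Y + h * A + h * B)
          ≈⟨ solve 6 (λ N h A B X Y →
               N :+ h :* (B :+ A :- con (+ 2) :* (X :- Y)) :- (con (+ 2) :* h :* Y :+ h :* A :+ h :* B)
               := N :- con (+ 2) :* h :* X) refl ∥ w ∥₂ h A B X Y ⟩
        ∥ w ∥₂ - fromℕ 2 * h * X
          ≈⟨ +-congˡ (-‿cong (expand w)) ⟨
        ∥ w ∥₂ - ⟨ g , w ⟩ ∎))
      where
      A = ∥ q ⊖ p ∥²
      B = ∥ w ⊖ q ∥²
      X = ⟨ p ⊖ q , w ⟩
      Y = ⟨ p ⊖ q , q ⟩

      expand : ∀ v → ⟨ g , v ⟩ ≈ fromℕ 2 * h * ⟨ p ⊖ q , v ⟩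
      expand v = trans (⟨⟩-⊙ˡ β (p ⊖ q) v) (*-congʳ (sym 2h≈β))

      negated : ∥ p ⊖ q ∥² ≈ A
      negated = sum-cong-≋ (λ j → solve 2 (λ p q → (p :- q) :* (p :- q) := (q :- p) :* (q :- p)) refl (p j) (q j))

      wp : ∥ w ⊖ p ∥² ≈ B + A - fromℕ 2 * (X - Y)
      wp = begin
        ∥ w ⊖ p ∥²                   ≈⟨ ⟨⟩-cong split split ⟩
        ∥ (w ⊖ q) ⊖ (p ⊖ q) ∥²       ≈⟨ ∥⊖∥² (w ⊖ q) (p ⊖ q) ⟩
        B + ∥ p ⊖ q ∥² - fromℕ 2 * ⟨ w ⊖ q , p ⊖ q ⟩
          ≈⟨ +-cong (+-congˡ negated) (-‿cong (*-congˡ (trans (⟨⟩-comm (w ⊖ q) (p ⊖ q)) (⟨⟩-⊖ʳ (p ⊖ q) w q)))) ⟩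
        B + A - fromℕ 2 * (X - Y)    ∎
        where
        split : w ⊖ p ≋ (w ⊖ q) ⊖ (p ⊖ q)
        split j = solve 3 (λ w p q → w :- p := w :- q :- (p :- q)) refl (w j) (p j) (q j)

-- The quadratic part minimised over x

module LeastSquares (R : RealField) where
  open LinearAlgebra R
  open OrderedField R
  open IntegerSolver R
  open InnerProduct R
  open SetoidReasoning setoid

  -- The hypothesis on δ is the weak form of the normal equations for x̄ with data ẑ.
  gap : ∀ {l m n} (D : Matrix l n) (K : Matrix m n) (f : Vector ℝ m) {c : ℝ} → 0# ≤ c →
        (x̄ : Vector ℝ n) (ẑ : Vector ℝ l) →
        (∀ δ → ⟨ ẑ ⊖ D *ᵥ x̄ , D *ᵥ δ ⟩ ≈ c * ⟨ K *ᵥ x̄ ⊖ f , K *ᵥ δ ⟩) →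
        (x : Vector ℝ n) (z : Vector ℝ l) →
        ∥ z ⊖ D *ᵥ x̄ ∥² + c * ∥ K *ᵥ x̄ ⊖ f ∥²
          ≤ ∥ z ⊖ D *ᵥ x ∥² + c * ∥ K *ᵥ x ⊖ f ∥² + ∥ z ⊖ ẑ ∥²
  gap D K f {c} 0≤c x̄ ẑ normal x z = ≤-fromNonneg
    -- Of the terms linear in `x - x̄`, the normal equations cancel all but `-2⟨e,p⟩`, which
    -- `∥e∥² + ∥p∥²` completes to a square.
    (+-nonneg (⟨v,v⟩-nonneg (e ⊖ p)) (*-nonneg 0≤c (⟨v,v⟩-nonneg q)))
    (begin
      ∥ e ⊖ p ∥² + c * ∥ q ∥²
        ≈⟨ +-congʳ (∥⊖∥² e p) ⟩
      E + P - fromℕ 2 * ep + c * Q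
        ≈⟨ solve 8 (λ E P ep c Q A B bq → E :+ P :- con (+ 2) :* ep :+ c :* Q
             := A :+ P :- con (+ 2) :* (ep :+ c :* bq) :+ c :* (B :+ Q :+ con (+ 2) :* bq) :+ E :- (A :+ c :* B))
             refl E P ep c Q A B bq ⟩
      A + P - fromℕ 2 * (ep + c * bq) + c * (B + Q + fromℕ 2 * bq) + E - (A + c * B)
        ≈⟨ +-congʳ (+-congʳ (+-cong (+-congˡ (-‿cong (*-congˡ ap))) (*-congˡ (∥⊕∥² b q)))) ⟨
      A + P - fromℕ 2 * ⟨ a , p ⟩ + c * ∥ b ⊕ q ∥² + E - (A + c * B)
        ≈⟨ +-congʳ (+-congʳ (+-congʳ (∥⊖∥² a p))) ⟨
      ∥ a ⊖ p ∥² + c * ∥ b ⊕ q ∥² + E - (A + c * B)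
        ≈⟨ +-congʳ (+-congʳ (+-cong (⟨⟩-cong a⊖p a⊖p) (*-congˡ (⟨⟩-cong b⊕q b⊕q)))) ⟩
      ∥ z ⊖ D *ᵥ x ∥² + c * ∥ K *ᵥ x ⊖ f ∥² + E - (A + c * B) ∎)
    where
    e = z ⊖ ẑ
    a = z ⊖ D *ᵥ x̄
    b = K *ᵥ x̄ ⊖ f
    p = D *ᵥ (x ⊖ x̄)
    q = K *ᵥ (x ⊖ x̄)
    E = ∥ e ∥²
    P = ∥ p ∥²
    Q = ∥ q ∥²
    A = ∥ a ∥²
    B = ∥ b ∥²
    ep = ⟨ e , p ⟩
    bq = ⟨ b , q ⟩

    ap : ⟨ a , p ⟩ ≈ ep + c * bq
    ap = begin
      ⟨ a , p ⟩
        ≈⟨ ⟨⟩-cong (λ i → solve 3 (λ z w y → z :- y := z :- w :+ (w :- y)) refl (z i) (ẑ i) ((D *ᵥ x̄) i)) (λ _ → refl) ⟩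
      ⟨ e ⊕ (ẑ ⊖ D *ᵥ x̄) , p ⟩    ≈⟨ ⟨⟩-⊕ˡ e (ẑ ⊖ D *ᵥ x̄) p ⟩
      ep + ⟨ ẑ ⊖ D *ᵥ x̄ , p ⟩     ≈⟨ +-congˡ (normal (x ⊖ x̄)) ⟩
      ep + c * bq                 ∎

    a⊖p : a ⊖ p ≋ z ⊖ D *ᵥ x
    a⊖p i = trans (+-congˡ (-‿cong (*ᵥ-⊖ D x x̄ i)))
      (solve 3 (λ z y w → z :- y :- (w :- y) := z :- w) refl (z i) ((D *ᵥ x̄) i) ((D *ᵥ x) i))

    b⊕q : b ⊕ q ≋ K *ᵥ x ⊖ f
    b⊕q i = trans (+-congˡ (*ᵥ-⊖ K x x̄ i))
      (solve 3 (λ y f w → y :- f :+ (w :- y) := w :- f) refl ((K *ᵥ x̄) i) (f i) ((K *ᵥ x) i))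

-- Momentum parameters and the energy estimate

module Acceleration (R : RealField) where
  open LinearAlgebra R
  open OrderedField R
  open IntegerSolver R
  open InnerProduct R
  open SetoidReasoning setoid

  momentum : ℝ → ℝ
  momentum t = (1# + √ (1# + fromℕ 4 * t ^ 2)) / fromℕ 2

  module _ {t : ℝ} (0≤t : 0# ≤ t) where
    private
      t² = t * t
      radicand = 1# + fromℕ 4 * t ^ 2
      σ = √ radicand
      t⁺ = momentum t

      radicand≈ : radicand ≈ 1# + fromℕ 4 * t²
      radicand≈ = +-congˡ (*-congˡ (^2≈* t))

      0≤radicand : 0# ≤ radicand
      0≤radicand = ≤-respʳ-≈ (sym radicand≈) (+-nonneg 0≤1 (*-nonneg (fromℕ-nonneg 4) (x*x-nonneg t)))

      σσ≈ : σ * σ ≈ 1# + fromℕ 4 * t²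
      σσ≈ = trans (√-square 0≤radicand) radicand≈

      2t⁺≈1+σ : fromℕ 2 * t⁺ ≈ 1# + σ
      2t⁺≈1+σ = trans (solve 3 (λ a x i → a :* (x :* i) := a :* i :* x) refl (fromℕ 2) (1# + σ) ½)
        (trans (*-congʳ 2*½) (*-identityˡ _))

    -- Follows from `√(1 + 4t²) ≥ 2t`. Iterated, it gives the linear growth of `t` and hence the
    -- quadratic rate.
    momentum-grows : fromℕ 2 * t + 1# ≤ fromℕ 2 * momentum t
    momentum-grows = ≤-respʳ-≈ (trans (+-comm _ _) (sym 2t⁺≈1+σ)) (+-mono-≤ 2t≤σ ≤-refl)
      where
      2t≤σ : fromℕ 2 * t ≤ σ
      2t≤σ = square-cancel-≤ (√-nonneg 0≤radicand) (≤-respʳ-≈ (sym σσ≈) (≤-fromNonneg 0≤1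
        (solve 1 (λ t → con (+ 1) := con (+ 1) :+ con (+ 4) :* (t :* t) :- con (+ 2) :* t :* (con (+ 2) :* t)) refl t)))

    -- With `u = momentum t`, four times the left side is `(2u - 1)² - 1 = σ² - 1`. The factor 4 is
    -- removed by cancelling 2 twice, which is available for `≤` and so applied in both directions.
    momentum-quadratic : momentum t * momentum t - momentum t ≈ t * t
    momentum-quadratic = antisym (cancel (≤-reflexive eq)) (cancel (≤-reflexive (sym eq)))
      where
      eq : fromℕ 2 * (fromℕ 2 * (t⁺ * t⁺ - t⁺)) ≈ fromℕ 2 * (fromℕ 2 * t²)
      eq = begin
        fromℕ 2 * (fromℕ 2 * (t⁺ * t⁺ - t⁺))
          ≈⟨ solve 1 (λ u → con (+ 2) :* (con (+ 2) :* (u :* u :- u))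
               := con (+ 2) :* u :* (con (+ 2) :* u) :- con (+ 2) :* (con (+ 2) :* u)) refl t⁺ ⟩
        fromℕ 2 * t⁺ * (fromℕ 2 * t⁺) - fromℕ 2 * (fromℕ 2 * t⁺)
          ≈⟨ +-cong (*-cong 2t⁺≈1+σ 2t⁺≈1+σ) (-‿cong (*-congˡ 2t⁺≈1+σ)) ⟩
        (1# + σ) * (1# + σ) - fromℕ 2 * (1# + σ)
          ≈⟨ solve 1 (λ s → (con (+ 1) :+ s) :* (con (+ 1) :+ s) :- con (+ 2) :* (con (+ 1) :+ s)
               := s :* s :- con (+ 1)) refl σ ⟩
        σ * σ - 1#
          ≈⟨ +-congʳ σσ≈ ⟩
        1# + fromℕ 4 * t² - 1#
          ≈⟨ solve 1 (λ x → con (+ 1) :+ con (+ 4) :* x :- con (+ 1) := con (+ 2) :* (con (+ 2) :* x)) refl t² ⟩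
        fromℕ 2 * (fromℕ 2 * t²) ∎
      cancel : ∀ {x y} → fromℕ 2 * (fromℕ 2 * x) ≤ fromℕ 2 * (fromℕ 2 * y) → x ≤ y
      cancel = double-cancel-≤ ∘ double-cancel-≤

  -- Puts weighted squared norms under one sum, so that an identity between them can be checked
  -- coordinatewise.
  combination : ∀ {n} (a b : ℝ) (u v w : Vector ℝ n) →
    a * ∥ u ∥² + b * ∥ v ∥² + ∥ w ∥² ≈ sum (λ i → a * (u i * u i) + b * (v i * v i) + w i * w i)
  combination a b u v w = sym (trans (∑-distrib-+ (λ i → a * (u i * u i) + b * (v i * v i)) (λ i → w i * w i))
    (+-congʳ (trans (∑-distrib-+ (λ i → a * (u i * u i)) (λ i → b * (v i * v i)))
      (+-cong (sym (*-distribˡ-sum a (λ i → u i * u i))) (sym (*-distribˡ-sum b (λ i → v i * v i)))))))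

  -- v k stands for Ψ(xᵏ,zᵏ) - Ψ(x*,z*) and s for z*.
  module _ {n} (h : ℝ) (s : Vector ℝ n) (v : ℕ → ℝ) (z ẑ : ℕ → Vector ℝ n) (t : ℕ → ℝ)
    (ẑ-init : ẑ 1 ≋ z 0)
    (t-init : t 1 ≈ 1#)
    (t-nonneg : ∀ k → 0# ≤ t (suc k))
    (t-quadratic : ∀ k → t (2 ℕ.+ k) * t (2 ℕ.+ k) - t (2 ℕ.+ k) ≈ t (suc k) * t (suc k))
    (extrapolation : ∀ k i → t (2 ℕ.+ k) * ẑ (2 ℕ.+ k) i
       ≈ t (2 ℕ.+ k) * z (suc k) i + (t (suc k) - 1#) * (z (suc k) i - z k i))
    (to-solution : ∀ k → v (suc k) + h * ∥ s ⊖ z (suc k) ∥² ≤ h * ∥ s ⊖ ẑ (suc k) ∥²)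
    (to-previous : ∀ k → v (2 ℕ.+ k) + h * ∥ z (suc k) ⊖ z (2 ℕ.+ k) ∥²
       ≤ v (suc k) + h * ∥ z (suc k) ⊖ ẑ (2 ℕ.+ k) ∥²)
    where

    private
      -- Shifted by one: `u k` is the vector u with index `k + 1` of the energy, because the
      -- iterates start at 1.
      u : ℕ → Vector ℝ n
      u k i = t (suc k) * z (suc k) i - (t (suc k) - 1#) * z k i - s i

    energy-decreases : ∀ k → t (suc k) * t (suc k) * v (suc k) + h * ∥ u k ∥² ≤ h * ∥ z 0 ⊖ s ∥²
    -- Since `t 1` is 1, the coefficient of `z 0` in `u 0` vanishes and the energy is the left side
    -- of `to-solution 0`.
    energy-decreases zero = ≤-respˡ-≈ lhs (≤-respʳ-≈ rhs (to-solution 0))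
      where
      lhs : v 1 + h * ∥ s ⊖ z 1 ∥² ≈ t 1 * t 1 * v 1 + h * ∥ u 0 ∥²
      lhs = sym (+-cong (trans (*-congʳ (trans (*-cong t-init t-init) (*-identityˡ 1#))) (*-identityˡ _))
        (*-congˡ (sum-cong-≋ (λ i → trans (*-cong (u≈ i) (u≈ i))
          (solve 2 (λ z s → (z :- s) :* (z :- s) := (s :- z) :* (s :- z)) refl (z 1 i) (s i))))))
        where
        u≈ : u 0 ≋ z 1 ⊖ s
        u≈ i = trans (+-congʳ (+-cong (*-congʳ t-init) (-‿cong (*-congʳ (+-congʳ t-init)))))
          (solve 3 (λ z y s → con (+ 1) :* z :- (con (+ 1) :- con (+ 1)) :* y :- s := z :- s) refl (z 1 i) (z 0 i) (s i))
      rhs : h * ∥ s ⊖ ẑ 1 ∥² ≈ h * ∥ z 0 ⊖ s ∥²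
      rhs = *-congˡ (sum-cong-≋ (λ i → trans (*-cong (+-congˡ (-‿cong (ẑ-init i))) (+-congˡ (-‿cong (ẑ-init i))))
        (solve 2 (λ z s → (s :- z) :* (s :- z) := (z :- s) :* (z :- s)) refl (z 0 i) (s i))))
    energy-decreases (suc k) = ≤-trans step (energy-decreases k)
      where
      T = t (suc k) * t (suc k)
      t⁺ = t (2 ℕ.+ k)
      V = v (suc k)
      V⁺ = v (2 ℕ.+ k)
      a = z (suc k)
      w = z (2 ℕ.+ k)
      y = ẑ (2 ℕ.+ k)

      -- The extrapolation is chosen for this: `u k` and `u (suc k)` become one expression,
      -- `t⁺ · - (t⁺ - 1) a - s`, evaluated at `y` and at `w`.
      u≈ : ∀ i → u k i ≈ t⁺ * y i - (t⁺ - 1#) * a i - s i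
      u≈ i = sym (trans (+-congʳ (+-congʳ (extrapolation k i)))
        (solve 5 (λ t t⁺ a z s → t⁺ :* a :+ (t :- con (+ 1)) :* (a :- z) :- (t⁺ :- con (+ 1)) :* a :- s
          := t :* a :- (t :- con (+ 1)) :* z :- s) refl (t (suc k)) t⁺ (a i) (z k i) (s i)))

      -- As functions of `y`, `T ∥a - y∥² + t⁺ ∥s - y∥²` and `∥t⁺ y - (t⁺ - 1) a - s∥²` have the
      -- same quadratic and linear terms, because `T = t⁺² - t⁺`. Their difference is therefore the
      -- same at `y` and at `w`.
      distances : T * ∥ a ⊖ y ∥² + t⁺ * ∥ s ⊖ y ∥² + ∥ u (suc k) ∥²
                ≈ T * ∥ a ⊖ w ∥² + t⁺ * ∥ s ⊖ w ∥² + ∥ u k ∥²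
      distances = trans (combination T t⁺ (a ⊖ y) (s ⊖ y) (u (suc k)))
        (trans (sum-cong-≋ pointwise) (sym (combination T t⁺ (a ⊖ w) (s ⊖ w) (u k))))
        where
        pointwise : ∀ i →
          T * ((a i - y i) * (a i - y i)) + t⁺ * ((s i - y i) * (s i - y i)) + u (suc k) i * u (suc k) i
          ≈ T * ((a i - w i) * (a i - w i)) + t⁺ * ((s i - w i) * (s i - w i)) + u k i * u k i
        pointwise i = trans (+-congʳ (+-congʳ (*-congʳ (sym (t-quadratic k)))))
          (trans (solve 5 (λ t a y s w →
            (t :* t :- t) :* ((a :- y) :* (a :- y)) :+ t :* ((s :- y) :* (s :- y))
              :+ (t :* w :- (t :- con (+ 1)) :* a :- s) :* (t :* w :- (t :- con (+ 1)) :* a :- s)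
            := (t :* t :- t) :* ((a :- w) :* (a :- w)) :+ t :* ((s :- w) :* (s :- w))
              :+ (t :* y :- (t :- con (+ 1)) :* a :- s) :* (t :* y :- (t :- con (+ 1)) :* a :- s))
            refl t⁺ (a i) (y i) (s i) (w i))
          (+-cong (+-congʳ (*-congʳ (t-quadratic k))) (sym (*-cong (u≈ i) (u≈ i)))))

      -- (t⁺² - t⁺) · (to-previous) + t⁺ · (to-solution), where t⁺² - t⁺ = T.
      step : t⁺ * t⁺ * V⁺ + h * ∥ u (suc k) ∥² ≤ T * V + h * ∥ u k ∥²
      step = ≤-fromNonneg
        (x≤y⇒0≤y-x (+-mono-≤ (*-monoˡ-≤ (x*x-nonneg (t (suc k))) (to-previous k))
                             (*-monoˡ-≤ (t-nonneg (suc k)) (to-solution (suc k)))))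
        (begin
          T * (V + h * AY) + t⁺ * (h * SY) - (T * (V⁺ + h * AW) + t⁺ * (V⁺ + h * SW))
            ≈⟨ solve 10 (λ T V h AY t SY V⁺ AW SW U⁺ →
                 T :* (V :+ h :* AY) :+ t :* (h :* SY) :- (T :* (V⁺ :+ h :* AW) :+ t :* (V⁺ :+ h :* SW))
                 := T :* V :+ h :* (T :* AY :+ t :* SY :+ U⁺ :- T :* AW :- t :* SW) :- ((T :+ t) :* V⁺ :+ h :* U⁺))
                 refl T V h AY t⁺ SY V⁺ AW SW U⁺ ⟩
          T * V + h * (T * AY + t⁺ * SY + U⁺ - T * AW - t⁺ * SW) - ((T + t⁺) * V⁺ + h * U⁺)
            ≈⟨ +-cong (+-congˡ (*-congˡ (+-congʳ (+-congʳ distances))))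
                      (-‿cong (+-congʳ (*-congʳ (+-congʳ (sym (t-quadratic k)))))) ⟩
          T * V + h * (T * AW + t⁺ * SW + U - T * AW - t⁺ * SW) - ((t⁺ * t⁺ - t⁺ + t⁺) * V⁺ + h * U⁺)
            ≈⟨ solve 9 (λ T V h t AW SW U V⁺ U⁺ →
                 T :* V :+ h :* (T :* AW :+ t :* SW :+ U :- T :* AW :- t :* SW) :- ((t :* t :- t :+ t) :* V⁺ :+ h :* U⁺)
                 := T :* V :+ h :* U :- (t :* t :* V⁺ :+ h :* U⁺)) refl T V h t⁺ AW SW U V⁺ U⁺ ⟩
          T * V + h * U - (t⁺ * t⁺ * V⁺ + h * U⁺) ∎)
        where
        AY = ∥ a ⊖ y ∥²
        SY = ∥ s ⊖ y ∥²
        AW = ∥ a ⊖ w ∥²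
        SW = ∥ s ⊖ w ∥²
        U = ∥ u k ∥²
        U⁺ = ∥ u (suc k) ∥²

-- The image model: blocks, objective, normal equations and the metric Q

module Convergence
  (R : RealField) (n m : ℕ) .{{_ : NonZero n}} .{{_ : NonZero m}}
  (K : LinearAlgebra.Matrix R m (n ℕ.* n)) (f : Vector (RealField.ℝ R) m)
  (μ β : RealField.ℝ R)
  (0<μ : RealField._<_ R (RealField.0# R) μ) (0<β : RealField._<_ R (RealField.0# R) β)
  where

  open LinearAlgebra R
  open Model.Problem R n m K f μ β 0<μ 0<β
  open OrderedField R
  open IntegerSolver R
  open InnerProduct R
  open Shrinkage R
  open LeastSquares R
  open Acceleration R
  open SetoidReasoning setoid

  c h : ℝ
  c = μ / β
  h = β / fromℕ 2

  0≤c : 0# ≤ c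
  0≤c = *-nonneg (proj₁ 0<μ) (⁻¹-nonneg 0<β)

  0≤h : 0# ≤ h
  0≤h = *-nonneg (proj₁ 0<β) 0≤½

  2h≈β : fromℕ 2 * h ≈ β
  2h≈β = trans (solve 3 (λ a b i → a :* (b :* i) := a :* i :* b) refl (fromℕ 2) β ½)
    (trans (*-congʳ 2*½) (*-identityˡ β))

  hc≈μ/2 : h * c ≈ μ / fromℕ 2
  hc≈μ/2 = trans (solve 4 (λ b i m j → b :* i :* (m :* j) := b :* j :* (m :* i)) refl β ½ μ (β ⁻¹))
    (trans (*-congʳ (⁻¹-inverseʳ β (proj₂ 0<β ∘ sym))) (*-identityˡ _))

  -- The matrix `D` is given by columns; symmetry of `Id` converts its entries to rows, on which
  -- `Id-*ᵥ` acts.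
  Id-difference : (a b : Fin N) (x : Vector ℝ N) → sum (λ j → (Id j a - Id j b) * x j) ≈ x a - x b
  Id-difference a b x = begin
    sum (λ j → (Id j a - Id j b) * x j)
      ≈⟨ sum-cong-≋ (λ j → *-congʳ (+-cong (reflexive (Id-sym j a)) (-‿cong (reflexive (Id-sym j b))))) ⟩
    ⟨ Id a ⊖ Id b , x ⟩      ≈⟨ ⟨⟩-⊖ˡ (Id a) (Id b) x ⟩
    (Id *ᵥ x) a - (Id *ᵥ x) b ≈⟨ +-cong (Id-*ᵥ x a) (-‿cong (Id-*ᵥ x b)) ⟩
    x a - x b                ∎

  -- Reconciles two descriptions of the differences: `Ψ` and the shrinkage use `Dᵢ`, the linear
  -- systems use `D`.
  block-D : ∀ i x → block (D *ᵥ x) i ≋ Dᵢ i x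
  block-D i x zero = trans
    (sum-cong-≋ (λ j → *-congʳ (reflexive (lookup-++ˡ (D⁽¹⁾ (Id j)) (D⁽²⁾ (Id j)) i))))
    (Id-difference (next₁ i) i x)
  block-D i x (suc zero) = trans
    (sum-cong-≋ (λ j → *-congʳ (reflexive (lookup-++ʳ (D⁽¹⁾ (Id j)) (D⁽²⁾ (Id j)) i))))
    (Id-difference (next₂ i) i x)

  block-⊖ : ∀ u v i → block (u ⊖ v) i ≋ block u i ⊖ block v i
  block-⊖ u v i zero       = refl
  block-⊖ u v i (suc zero) = refl

  ∥∥²-blocks : ∀ w → ∥ w ∥² ≈ sum (λ i → ∥ block w i ∥²)
  ∥∥²-blocks w = begin
    ∥ w ∥²                     ≈⟨ sum-++ N (λ i → w i * w i) ⟩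
    sum w₁² + sum w₂²          ≈⟨ ∑-distrib-+ w₁² w₂² ⟨
    sum (λ i → w₁² i + w₂² i)  ≈⟨ sum-cong-≋ (λ i → +-congˡ (+-identityʳ (w₂² i))) ⟨
    sum (λ i → ∥ block w i ∥²) ∎
    where
    w₁² w₂² : Vector ℝ N
    w₁² i = w (i ↑ˡ N) * w (i ↑ˡ N)
    w₂² i = w (N ↑ʳ i) * w (N ↑ʳ i)

  ∥⊖∥²-blocks : ∀ u v → ∥ u ⊖ v ∥² ≈ sum (λ i → ∥ block u i ⊖ block v i ∥²)
  ∥⊖∥²-blocks u v = trans (∥∥²-blocks (u ⊖ v)) (sum-cong-≋ (λ i → ⟨⟩-cong (block-⊖ u v i) (block-⊖ u v i)))

  ∥⊖D∥²-blocks : ∀ z x → ∥ z ⊖ D *ᵥ x ∥² ≈ sum (λ i → ∥ block z i ⊖ Dᵢ i x ∥²)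
  ∥⊖D∥²-blocks z x = trans (∥⊖∥²-blocks z (D *ᵥ x)) (sum-cong-≋ (λ i → ⟨⟩-cong (eq i) (eq i)))
    where
    eq : ∀ i → block z i ⊖ block (D *ᵥ x) i ≋ block z i ⊖ Dᵢ i x
    eq i j = +-congˡ (-‿cong (block-D i x j))

  ∥∥₂^2≈ : ∀ {l} (v : Vector ℝ l) → ∥ v ∥₂ ^ 2 ≈ ∥ v ∥²
  ∥∥₂^2≈ v = trans (^2≈* ∥ v ∥₂) (∥∥₂-square v)

  Φ : Vector ℝ (N ℕ.+ N) → ℝ
  Φ z = ∑[ i < N ] ∥ block z i ∥₂

  -- Pulling `h = β/2` out of the quadratic part of `Ψ` leaves the weight `μ / β` of `W`, so
  -- `SolvesW` is the normal equation of `G` in `x`.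
  G : Vector ℝ N → Vector ℝ (N ℕ.+ N) → ℝ
  G x z = ∥ z ⊖ D *ᵥ x ∥² + c * ∥ K *ᵥ x ⊖ f ∥²

  Ψ≈Φ+hG : ∀ x z → Ψ x z ≈ Φ z + h * G x z
  Ψ≈Φ+hG x z = begin
    Ψ x z
      ≈⟨ +-cong (+-congˡ (*-congˡ (trans (sum-cong-≋ (λ i → ∥∥₂^2≈ (block z i ⊖ Dᵢ i x))) (sym (∥⊖D∥²-blocks z x)))))
                (*-cong (sym hc≈μ/2) (∥∥₂^2≈ (K *ᵥ x ⊖ f))) ⟩
    Φ z + h * A + h * c * B
      ≈⟨ solve 5 (λ F h A c B → F :+ h :* A :+ h :* c :* B := F :+ h :* (A :+ c :* B)) refl (Φ z) h A c B ⟩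
    Φ z + h * G x z ∎
    where
    A = ∥ z ⊖ D *ᵥ x ∥²
    B = ∥ K *ᵥ x ⊖ f ∥²

  W-apply : ∀ x → W *ᵥ x ≋ D ᵀ *ᵥ (D *ᵥ x) ⊕ c ⊙ (K ᵀ *ᵥ (K *ᵥ x))
  W-apply x i = trans (⊞-*ᵥ (D ᵀ ⊗ D) (c ⊡ (K ᵀ ⊗ K)) x i)
    (+-cong (⊗-*ᵥ (D ᵀ) D x i) (trans (⊡-*ᵥ c (K ᵀ ⊗ K) x i) (*-congˡ (⊗-*ᵥ (K ᵀ) K x i))))

  -- Pairing the system with `δ` and moving the transposes across yields `balance`, of which this is
  -- a rearrangement.
  normal-equations : ∀ {x z} → SolvesW x z → ∀ δ →
    ⟨ z ⊖ D *ᵥ x , D *ᵥ δ ⟩ ≈ c * ⟨ K *ᵥ x ⊖ f , K *ᵥ δ ⟩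
  normal-equations {x} {z} solves δ = begin
    ⟨ z ⊖ D *ᵥ x , Dδ ⟩                  ≈⟨ ⟨⟩-⊖ˡ z (D *ᵥ x) Dδ ⟩
    dz - dx                              ≈⟨ solve 3 (λ a b d → a :- b := a :+ d :- b :- d) refl dz dx (c * kf) ⟩
    dz + c * kf - dx - c * kf            ≈⟨ +-congʳ (+-congʳ (sym balance)) ⟩
    dx + c * kx - dx - c * kf            ≈⟨ solve 4 (λ a c k l → a :+ c :* k :- a :- c :* l := c :* (k :- l)) refl dx c kx kf ⟩
    c * (kx - kf)                        ≈⟨ *-congˡ (⟨⟩-⊖ˡ (K *ᵥ x) f Kδ) ⟨
    c * ⟨ K *ᵥ x ⊖ f , Kδ ⟩              ∎
    where
    Dδ = D *ᵥ δ
    Kδ = K *ᵥ δ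
    dz = ⟨ z , Dδ ⟩
    dx = ⟨ D *ᵥ x , Dδ ⟩
    kx = ⟨ K *ᵥ x , Kδ ⟩
    kf = ⟨ f , Kδ ⟩

    adjoint : ∀ y g → ⟨ δ , D ᵀ *ᵥ y ⊕ c ⊙ (K ᵀ *ᵥ g) ⟩ ≈ ⟨ y , Dδ ⟩ + c * ⟨ g , Kδ ⟩
    adjoint y g = trans (⟨⟩-⊕ʳ δ (D ᵀ *ᵥ y) (c ⊙ (K ᵀ *ᵥ g))) (+-cong
      (trans (⟨x,Aᵀy⟩≈⟨Ax,y⟩ D δ y) (⟨⟩-comm Dδ y))
      (trans (⟨⟩-⊙ʳ c δ (K ᵀ *ᵥ g)) (*-congˡ (trans (⟨x,Aᵀy⟩≈⟨Ax,y⟩ K δ g) (⟨⟩-comm Kδ g)))))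

    balance : dx + c * kx ≈ dz + c * kf
    balance = begin
      dx + c * kx                                              ≈⟨ sym (adjoint (D *ᵥ x) (K *ᵥ x)) ⟩
      ⟨ δ , D ᵀ *ᵥ (D *ᵥ x) ⊕ c ⊙ (K ᵀ *ᵥ (K *ᵥ x)) ⟩          ≈⟨ ⟨⟩-cong (λ _ → refl) (λ i → sym (W-apply x i)) ⟩
      ⟨ δ , W *ᵥ x ⟩                                           ≈⟨ ⟨⟩-cong (λ _ → refl) solves ⟩
      ⟨ δ , D ᵀ *ᵥ z ⊕ c ⊙ (K ᵀ *ᵥ f) ⟩                        ≈⟨ adjoint z f ⟩
      dz + c * kf                                              ∎

  G-gap : ∀ {x̄ ẑ} → SolvesW x̄ ẑ → ∀ x z → G x̄ z ≤ G x z + ∥ z ⊖ ẑ ∥²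
  G-gap {x̄} {ẑ} solves = gap D K f 0≤c x̄ ẑ (normal-equations solves)

  -- ⟨u, D W⁻¹ Dᵀ u⟩ = ⟨W y, y⟩ ≥ 0 for y = W⁻¹ Dᵀ u.
  ∥∥²≤Q : ∀ ker (u : Vector ℝ (N ℕ.+ N)) → ∥ u ∥² ≤ ∥ u ∥²[ Q ker ]
  ∥∥²≤Q ker u = ≤-fromNonneg
    (+-nonneg (⟨v,v⟩-nonneg (D *ᵥ y)) (*-nonneg 0≤c (⟨v,v⟩-nonneg (K *ᵥ y))))
    (begin
      ∥ D *ᵥ y ∥² + c * ∥ K *ᵥ y ∥²   ≈⟨ sym (⟨x,Wx⟩ y) ⟩
      ⟨ y , W *ᵥ y ⟩                  ≈⟨ ⟨⟩-cong (λ _ → refl) Wy ⟩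
      ⟨ y , D ᵀ *ᵥ u ⟩                ≈⟨ ⟨x,Aᵀy⟩≈⟨Ax,y⟩ D y u ⟩
      ⟨ D *ᵥ y , u ⟩                  ≈⟨ ⟨⟩-comm (D *ᵥ y) u ⟩
      ⟨ u , D *ᵥ y ⟩                  ≈⟨ solve 2 (λ a b → b := a :+ b :- a) refl (∥ u ∥²) ⟨ u , D *ᵥ y ⟩ ⟩
      ∥ u ∥² + ⟨ u , D *ᵥ y ⟩ - ∥ u ∥² ≈⟨ +-congʳ (sym (⟨⟩-⊕ʳ u u (D *ᵥ y))) ⟩
      ⟨ u , u ⊕ D *ᵥ y ⟩ - ∥ u ∥²     ≈⟨ +-congʳ (⟨⟩-cong (λ _ → refl) (λ i → sym (Qu i))) ⟩
      ∥ u ∥²[ Q ker ] - ∥ u ∥²        ∎)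
    where
    y = W⁻¹ ker *ᵥ (D ᵀ *ᵥ u)

    Wy : W *ᵥ y ≋ D ᵀ *ᵥ u
    Wy i = begin
      (W *ᵥ y) i                            ≈⟨ ⊗-*ᵥ W (W⁻¹ ker) (D ᵀ *ᵥ u) i ⟨
      ((W ⊗ W⁻¹ ker) *ᵥ (D ᵀ *ᵥ u)) i       ≈⟨ sum-cong-≋ (λ j → *-congʳ (proj₁ (proj₂ (W-invertible ker)) i j)) ⟩
      (Id *ᵥ (D ᵀ *ᵥ u)) i                  ≈⟨ Id-*ᵥ (D ᵀ *ᵥ u) i ⟩
      (D ᵀ *ᵥ u) i                          ∎

    Qu : Q ker *ᵥ u ≋ u ⊕ D *ᵥ y
    Qu i = trans (⊞-*ᵥ Id (D ⊗ W⁻¹ ker ⊗ D ᵀ) u i)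
      (+-cong (Id-*ᵥ u i) (trans (⊗-*ᵥ (D ⊗ W⁻¹ ker) (D ᵀ) u i) (⊗-*ᵥ D (W⁻¹ ker) (D ᵀ *ᵥ u) i)))

  -- The proximal problem separates over pixels, so `shrink-prox` is summed.
  Φ-prox : ∀ {x̄ z} →
    (∀ i → block z i ≋ λ j → ((∥ Dᵢ i x̄ ∥₂ - 1# / β) ⊔ 0#) * (Dᵢ i x̄ j / ∥ Dᵢ i x̄ ∥₂)) →
    ∀ w → Φ z + h * ∥ z ⊖ D *ᵥ x̄ ∥² + h * ∥ w ⊖ z ∥² ≤ Φ w + h * ∥ w ⊖ D *ᵥ x̄ ∥²
  Φ-prox {x̄} {z} shrunk w = ≤-respˡ-≈ (sym lhs) (≤-respʳ-≈ (sym rhs)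
    (sum-mono-≤ (λ i → shrink-prox 0<β (Dᵢ i x̄) (block z i) (shrunk i) 2h≈β (block w i))))
    where
    zD wD wz : Vector ℝ N
    zD i = ∥ block z i ⊖ Dᵢ i x̄ ∥²
    wD i = ∥ block w i ⊖ Dᵢ i x̄ ∥²
    wz i = ∥ block w i ⊖ block z i ∥²

    scaled-sum : ∀ {a} (v : Vector ℝ N) → a ≈ sum v → h * a ≈ sum (λ i → h * v i)
    scaled-sum v a≈ = trans (*-congˡ a≈) (*-distribˡ-sum h v)

    lhs : Φ z + h * ∥ z ⊖ D *ᵥ x̄ ∥² + h * ∥ w ⊖ z ∥² ≈ sum (λ i → ∥ block z i ∥₂ + h * zD i + h * wz i)
    lhs = begin
      Φ z + h * ∥ z ⊖ D *ᵥ x̄ ∥² + h * ∥ w ⊖ z ∥²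
        ≈⟨ +-cong (+-congˡ (scaled-sum zD (∥⊖D∥²-blocks z x̄))) (scaled-sum wz (∥⊖∥²-blocks w z)) ⟩
      Φ z + sum (λ i → h * zD i) + sum (λ i → h * wz i)
        ≈⟨ +-congʳ (∑-distrib-+ (λ i → ∥ block z i ∥₂) (λ i → h * zD i)) ⟨
      sum (λ i → ∥ block z i ∥₂ + h * zD i) + sum (λ i → h * wz i)
        ≈⟨ ∑-distrib-+ (λ i → ∥ block z i ∥₂ + h * zD i) (λ i → h * wz i) ⟨
      sum (λ i → ∥ block z i ∥₂ + h * zD i + h * wz i) ∎

    rhs : Φ w + h * ∥ w ⊖ D *ᵥ x̄ ∥² ≈ sum (λ i → ∥ block w i ∥₂ + h * wD i)
    rhs = trans (+-congˡ (scaled-sum wD (∥⊖D∥²-blocks w x̄)))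
      (sym (∑-distrib-+ (λ i → ∥ block w i ∥₂) (λ i → h * wD i)))

  -- One step of the algorithm and its energy bound

  module _ {x̄ x : ℕ → Vector ℝ N} {z ẑ : ℕ → Vector ℝ (N ℕ.+ N)} {t : ℕ → ℝ}
    (algorithm : Algorithm2 x̄ x z ẑ t) where
    open Algorithm2 algorithm

    -- Add `x-gap`, `Φ-prox` and `G-gap` with weights `h`, 1, `h`: the intermediate values
    -- `G (x̄ k) (z k)` and `G (x̄ k) w` cancel.
    descent : ∀ k → 1 ℕ.≤ k → ∀ x′ w →
      Ψ (x k) (z k) + h * ∥ w ⊖ z k ∥² ≤ Ψ x′ w + h * ∥ w ⊖ ẑ k ∥²
    descent k 1≤k x′ w = ≤-respˡ-≈ (+-congʳ (sym (Ψ≈Φ+hG (x k) (z k))))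
      (≤-respʳ-≈ (+-congʳ (sym (Ψ≈Φ+hG x′ w)))
        (≤-fromNonneg
          (+-nonneg (+-nonneg (*-nonneg 0≤h (x≤y⇒0≤y-x x-gap)) (x≤y⇒0≤y-x (Φ-prox (z-step k 1≤k) w)))
                    (*-nonneg 0≤h (x≤y⇒0≤y-x (G-gap (x̄-step k 1≤k) x′ w))))
          (solve 10 (λ h G₁ A cB F WZ F′ A′ G₃ E →
            h :* (A :+ cB :- G₁) :+ (F′ :+ h :* A′ :- (F :+ h :* A :+ h :* WZ)) :+ h :* (G₃ :+ E :- (A′ :+ cB))
            := F′ :+ h :* G₃ :+ h :* E :- (F :+ h :* G₁ :+ h :* WZ)) refl
            h (G (x k) (z k)) (∥ z k ⊖ D *ᵥ x̄ k ∥²) (c * ∥ K *ᵥ x̄ k ⊖ f ∥²) (Φ (z k)) (∥ w ⊖ z k ∥²)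
            (Φ w) (∥ w ⊖ D *ᵥ x̄ k ∥²) (G x′ w) (∥ w ⊖ ẑ k ∥²))))
      where
      x-gap : G (x k) (z k) ≤ G (x̄ k) (z k)
      -- With data and argument both equal to `z k`, the distance term of `G-gap` vanishes, so `x k`
      -- minimises `G` for that data.
      x-gap = ≤-respʳ-≈
        (trans (+-congˡ (sum-zero (λ i → trans (*-congʳ (-‿inverseʳ (z k i))) (zeroˡ _)))) (+-identityʳ _))
        (G-gap (x-step k 1≤k) (x̄ k) (z k))

    -- Declared ahead of its proof: the induction step needs `t-nonneg` at the previous index, and
    -- `t-nonneg` is read off from this bound.
    2t-lower : ∀ k → fromℕ (2 ℕ.+ k) ≤ fromℕ 2 * t (suc k)

    t-nonneg : ∀ k → 0# ≤ t (suc k)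
    t-nonneg k = double-cancel-≤ (≤-respˡ-≈ (sym (zeroʳ _)) (≤-trans (fromℕ-nonneg (2 ℕ.+ k)) (2t-lower k)))

    2t-lower zero    = ≤-reflexive (sym (trans (*-congˡ t-init) (*-identityʳ _)))
    2t-lower (suc k) = ≤-trans (+-mono-≤ ≤-refl (2t-lower k))
      (≤-respˡ-≈ (+-comm _ _) (≤-respʳ-≈ (*-congˡ (sym (t-step (suc k) (s≤s z≤n)))) (momentum-grows (t-nonneg k))))

    t-quadratic : ∀ k → t (2 ℕ.+ k) * t (2 ℕ.+ k) - t (2 ℕ.+ k) ≈ t (suc k) * t (suc k)
    t-quadratic k = trans (+-cong (*-cong step step) (-‿cong step)) (momentum-quadratic (t-nonneg k))
      where step = t-step (suc k) (s≤s z≤n)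

    t≉0 : ∀ k → t (suc k) ≉ 0#
    t≉0 k t≈0 = fromℕ-suc≉0 (suc k)
      (antisym (≤-respʳ-≈ (trans (*-congˡ t≈0) (zeroʳ _)) (2t-lower k)) (fromℕ-nonneg (2 ℕ.+ k)))

    extrapolation : ∀ k i → t (2 ℕ.+ k) * ẑ (2 ℕ.+ k) i
      ≈ t (2 ℕ.+ k) * z (suc k) i + (t (suc k) - 1#) * (z (suc k) i - z k i)
    extrapolation k i = begin
      t⁺ * ẑ (2 ℕ.+ k) i                       ≈⟨ *-congˡ (ẑ-step (suc k) (s≤s z≤n) i) ⟩
      t⁺ * (z (suc k) i + a * t⁺ ⁻¹ * d)
        ≈⟨ solve 5 (λ t z a j d → t :* (z :+ a :* j :* d) := t :* z :+ t :* j :* (a :* d))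
             refl t⁺ (z (suc k) i) a (t⁺ ⁻¹) d ⟩
      t⁺ * z (suc k) i + t⁺ * t⁺ ⁻¹ * (a * d)  ≈⟨ +-congˡ (trans (*-congʳ (⁻¹-inverseʳ t⁺ (t≉0 (suc k)))) (*-identityˡ _)) ⟩
      t⁺ * z (suc k) i + a * d                 ∎
      where
      t⁺ = t (2 ℕ.+ k)
      a = t (suc k) - 1#
      d = z (suc k) i - z k i

    -- `descent` is applied against `(x*, z*)` and against the previous iterate, with `Ψ x* z*`
    -- subtracted; the nonnegative `residual` part of the energy is then dropped.
    energy-bound : ∀ x* z* k →
      t (suc k) * t (suc k) * (Ψ (x (suc k)) (z (suc k)) - Ψ x* z*) ≤ h * ∥ z 0 ⊖ z* ∥²
    energy-bound x* z* k = ≤-trans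
      (≤-fromNonneg (*-nonneg 0≤h (⟨v,v⟩-nonneg residual))
        (solve 2 (λ a b → b := a :+ b :- a) refl _ (h * ∥ residual ∥²)))
      (energy-decreases h z* (λ k → Ψ (x k) (z k) - Ψ x* z*) z ẑ t ẑ-init t-init t-nonneg t-quadratic extrapolation
        (λ k → ≤-fromNonneg (x≤y⇒0≤y-x (descent (suc k) (s≤s z≤n) x* z*))
          (solve 4 (λ p a q b → q :+ b :- (p :+ a) := b :- (p :- q :+ a)) refl _ _ _ _))
        (λ k → ≤-fromNonneg (x≤y⇒0≤y-x (descent (2 ℕ.+ k) (s≤s z≤n) (x (suc k)) (z (suc k))))
          (solve 5 (λ p a q b r → q :+ b :- (p :+ a) := q :- r :+ b :- (p :- r :+ a)) refl _ _ _ _ (Ψ x* z*)))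
        k)
      where
      residual : Vector ℝ (N ℕ.+ N)
      residual i = t (suc k) * z (suc k) i - (t (suc k) - 1#) * z k i - z* i

  -- The constant arises from `m² v ≤ 4t² v ≤ 4h A` with `4h = 2β`.
  rate : ∀ {t m v A B} → 0# ≤ m → m ≉ 0# → m ≤ fromℕ 2 * t → 0# ≤ A → A ≤ B →
         t * t * v ≤ h * A → v ≤ (fromℕ 2 * β * B) / m ^ 2
  rate {t} {m} {v} {A} {B} 0≤m m≉0 m≤2t 0≤A A≤B ttv≤hA =
    ≤-respˡ-≈ cancel (≤-respʳ-≈ (*-comm _ _) (*-monoˡ-≤ (⁻¹-nonneg (0≤m² , m²≉0 ∘ sym)) m²v≤))
    where
    0≤m² : 0# ≤ m ^ 2
    0≤m² = ≤-respʳ-≈ (sym (^2≈* m)) (x*x-nonneg m)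

    m²≉0 : m ^ 2 ≉ 0#
    m²≉0 e = m≉0 (x*x≈0⇒x≈0 (trans (sym (^2≈* m)) e))

    cancel : (m ^ 2) ⁻¹ * (m ^ 2 * v) ≈ v
    cancel = trans (sym (*-assoc _ _ _)) (trans (*-congʳ (⁻¹-inverseˡ (m ^ 2) m²≉0)) (*-identityˡ v))

    0≤2β : 0# ≤ fromℕ 2 * β
    0≤2β = *-nonneg (fromℕ-nonneg 2) (proj₁ 0<β)

    m²v≤ : m ^ 2 * v ≤ fromℕ 2 * β * B
    -- Replacing `m²` by `4t²` needs a nonnegative `v`; otherwise the nonnegative right side already
    -- suffices.
    m²v≤ with total v 0#
    ... | inj₁ v≤0 = ≤-trans (≤-respʳ-≈ (zeroʳ _) (*-monoˡ-≤ 0≤m² v≤0)) (*-nonneg 0≤2β (≤-trans 0≤A A≤B))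
    ... | inj₂ 0≤v = ≤-trans (≤-respˡ-≈ (*-congʳ (sym (^2≈* m))) m²v≤4t²v)
          (≤-trans (*-monoˡ-≤ (fromℕ-nonneg 4) ttv≤hA)
            (≤-respˡ-≈ (trans (*-congʳ (*-congˡ (sym 2h≈β)))
              (solve 2 (λ h A → con (+ 2) :* (con (+ 2) :* h) :* A := con (+ 4) :* (h :* A)) refl h A))
              (*-monoˡ-≤ 0≤2β A≤B)))
      where
      -- 4t² - m² = (2t - m)(2t - m + 2m)
      m²v≤4t²v : m * m * v ≤ fromℕ 4 * (t * t * v)
      m²v≤4t²v = ≤-fromNonneg
        (*-nonneg (*-nonneg (x≤y⇒0≤y-x m≤2t) (+-nonneg (x≤y⇒0≤y-x m≤2t) (*-nonneg (fromℕ-nonneg 2) 0≤m))) 0≤v)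
        (solve 3 (λ t m v → (con (+ 2) :* t :- m) :* (con (+ 2) :* t :- m :+ con (+ 2) :* m) :* v
          := con (+ 4) :* (t :* t :* v) :- m :* m :* v) refl t m v)

theorem4p1 : (R : RealField) → let open LinearAlgebra R in
    (n m : ℕ) .{{_ : NonZero n}} .{{_ : NonZero m}}
    (K : Matrix m (n ℕ.* n)) (f : Vector ℝ m)
    (μ β : ℝ) (0<μ : 0# < μ) (0<β : 0# < β) →
    let open Model.Problem R n m K f μ β 0<μ 0<β in
    (ker : KernelsMeetTrivially)
    (x* : Vector ℝ N) (z* : Vector ℝ (N ℕ.+ N)) → IsMinimizer x* z* →
    (x̄ x : ℕ → Vector ℝ N) (z ẑ : ℕ → Vector ℝ (N ℕ.+ N)) (t : ℕ → ℝ) →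
    Algorithm2 x̄ x z ẑ t →
    ∀ k → 1 ℕ.≤ k →
    Ψ (x k) (z k) - Ψ x* z*
    ≤ (fromℕ 2 * β * ∥ z 0 ⊖ z* ∥²[ Q ker ]) / fromℕ (k ℕ.+ 1) ^ 2
theorem4p1 R n m K f μ β 0<μ 0<β ker x* z* _ x̄ x z ẑ t algorithm (suc k) _
  -- The index is `suc k`, so the denominator is built from `suc (k + 1)`; this matches it with
  -- `2 + k` in `2t-lower`.
  rewrite ℕ.+-comm k 1 =
  rate (fromℕ-nonneg (2 ℕ.+ k)) (fromℕ-suc≉0 (suc k)) (2t-lower algorithm k)
    (⟨v,v⟩-nonneg (z 0 ⊖ z*)) (∥∥²≤Q ker (z 0 ⊖ z*)) (energy-bound algorithm x* z* k)
  where
  open LinearAlgebra R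
  open OrderedField R
  open Convergence R n m K f μ β 0<μ 0<β
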